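{- Let $L$ be a graph with radius two. Then there exists $n$ such that $\mathrm{Tr}(n)\to L$ if and only if $L$ is a subgraph of a jellyfish $J_k$ or of a bistar $B_k$ for some positive integer $k$.
   Context: For graphs $G$ and $H$, write $G\to H$ if every 2-edge-coloring of $G$ contains a monochromatic copy of $H$ (a subgraph isomorphic to $H$ all of whose edges have the same color). The iterated triangulation $\mathrm{Tr}(n)$ is the plane graph defined recursively: $\mathrm{Tr}(0)\cong K_3$ is the plane triangle; for $i\ge 0$, $\mathrm{Tr}(i+1)$ is obtained from $\mathrm{Tr}(i)$ by placing a new vertex inside each inner face of $\mathrm{Tr}(i)$ and joining it by edges to the three vertices on the boundary of that face. A flower $F_k$ is a collection of $k$ copies of $C_4$ sharing exactly one common vertex, called the center. A jellyfish $J_k$ is obtained from $F_k$ and a $k$-ary tree of radius two (rooted tree whose root has $k$ children, each of which has $k$ children) by identifying the center of $F_k$ with the root of the tree. A bistar $B_k$ is obtained from one $C_4$ and two disjoint stars $K_{1,k}$ by identifying the centers (roots) of the two stars with the two vertices of a pair of non-adjacent vertices of the $C_4$, respectively. -}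

module Defs where

open import Data.Nat using (ℕ; zero; suc; _≤_)
open import Data.Fin using (Fin; zero; suc)
open import Data.Bool using (Bool)
open import Data.Unit using (⊤; tt)
open import Data.Empty using (⊥)
open import Data.Sum using (_⊎_; inj₁; inj₂)
open import Data.Product using (Σ; _×_; _,_; ∃; ∃-syntax)
open import Relation.Nullary using (¬_)
open import Relation.Binary.PropositionalEquality using (_≡_; _≢_; refl)

record Graph (V : Set) : Set₁ where
  field
    E     : V → V → Set
    E-sym : ∀ {u v} → E u v → E v u
    E-irr : ∀ {u} → ¬ E u u
open Graph public

record _⊆G_ {VH VG : Set} (H : Graph VH) (G : Graph VG) : Set where
  field
    emb     : VH → VG
    emb-inj : ∀ {u v} → emb u ≡ emb v → u ≡ v
    emb-E   : ∀ {u v} → E H u v → E G (emb u) (emb v)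

-- A 2-edge-colouring of G: a colour for every (unordered) pair,
-- i.e. a symmetric Bool-valued function (only values on edges matter).
record Colouring {V : Set} (G : Graph V) : Set where
  field
    col     : V → V → Bool
    col-sym : ∀ u v → col u v ≡ col v u
open Colouring public

record MonoCopy {VH VG : Set} (G : Graph VG) (c : Colouring G)
                (b : Bool) (H : Graph VH) : Set where
  field
    emb     : VH → VG
    emb-inj : ∀ {u v} → emb u ≡ emb v → u ≡ v
    emb-E   : ∀ {u v} → E H u v → E G (emb u) (emb v)
    emb-col : ∀ {u v} → E H u v → col c (emb u) (emb v) ≡ b

_⟶_ : {VG VH : Set} → Graph VG → Graph VH → Set
G ⟶ H = (c : Colouring G) → Σ Bool λ b → MonoCopy G c b H

data Within {V : Set} (G : Graph V) : ℕ → V → V → Set where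
  here : ∀ {k v} → Within G k v v
  step : ∀ {k u w v} → E G u w → Within G k w v → Within G (suc k) u v

Ecc≤ : {V : Set} → Graph V → ℕ → V → Set
Ecc≤ G k v = ∀ u → Within G k v u

RadiusTwo : {V : Set} → Graph V → Set
RadiusTwo G = (∃[ v ] Ecc≤ G 2 v) × ¬ (∃[ v ] Ecc≤ G 1 v)

mutual
  Vtx : ℕ → Set
  Vtx zero    = Fin 3
  Vtx (suc n) = Vtx n ⊎ Face n          -- new vertex per inner face

  -- inner faces of Tr(n)
  Face : ℕ → Set
  Face zero    = ⊤
  Face (suc n) = Face n × Fin 3         -- each face splits into three

-- which two old corners (0,1,2) of the parent face face j of the split uses
pick : Fin 3 → Fin 2 → Fin 3
pick zero             zero       = zero
pick zero             (suc _)    = suc zero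
pick (suc zero)       zero       = suc zero
pick (suc zero)       (suc _)    = suc (suc zero)
pick (suc (suc _))    zero       = zero
pick (suc (suc _))    (suc _)    = suc (suc zero)

corner : (n : ℕ) → Face n → Fin 3 → Vtx n
corner zero    tt      i             = i
corner (suc n) (f , j) zero          = inj₁ (corner n f (pick j zero))
corner (suc n) (f , j) (suc zero)    = inj₁ (corner n f (pick j (suc zero)))
corner (suc n) (f , j) (suc (suc _)) = inj₂ f

data TrE : (n : ℕ) → Vtx n → Vtx n → Set where
  base : {u v : Fin 3} → u ≢ v → TrE zero u v
  old  : ∀ {n u v} → TrE n u v → TrE (suc n) (inj₁ u) (inj₁ v)
  down : ∀ {n} (f : Face n) (i : Fin 3) → TrE (suc n) (inj₂ f) (inj₁ (corner n f i))
  up   : ∀ {n} (f : Face n) (i : Fin 3) → TrE (suc n) (inj₁ (corner n f i)) (inj₂ f)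

private
  TrE-sym : ∀ {n u v} → TrE n u v → TrE n v u
  TrE-sym (base p) = base (λ q → p (sym' q))
    where
      sym' : ∀ {A : Set} {x y : A} → x ≡ y → y ≡ x
      sym' refl = refl
  TrE-sym (old e)    = old (TrE-sym e)
  TrE-sym (down f i) = up f i
  TrE-sym (up f i)   = down f i

  TrE-irr : ∀ {n u} → ¬ TrE n u u
  TrE-irr (base p) = p refl
  TrE-irr (old e)  = TrE-irr e

Tr : (n : ℕ) → Graph (Vtx n)
Tr n = record { E = TrE n ; E-sym = TrE-sym ; E-irr = TrE-irr }

data JV (k : ℕ) : Set where
  root  : JV k
  petal : Fin k → Fin 3 → JV k      -- the 3 non-centre vertices of the i-th C4
  child : Fin k → JV k
  gchild : Fin k → Fin k → JV k

data JE (k : ℕ) : JV k → JV k → Set where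
  p0 : ∀ i → JE k root (petal i zero)
  p1 : ∀ i → JE k (petal i zero) (petal i (suc zero))
  p2 : ∀ i → JE k (petal i (suc zero)) (petal i (suc (suc zero)))
  p3 : ∀ i → JE k (petal i (suc (suc zero))) root
  t1 : ∀ j → JE k root (child j)
  t2 : ∀ j l → JE k (child j) (gchild j l)

private
  JE-irr : ∀ {k u} → ¬ JE k u u
  JE-irr ()

Jelly : (k : ℕ) → Graph (JV k)
Jelly k = record
  { E = λ u v → JE k u v ⊎ JE k v u
  ; E-sym = λ { (inj₁ e) → inj₂ e ; (inj₂ e) → inj₁ e }
  ; E-irr = λ { (inj₁ e) → JE-irr e ; (inj₂ e) → JE-irr e } }

data BV (k : ℕ) : Set where
  c4    : Fin 4 → BV k
  leafA : Fin k → BV k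
  leafB : Fin k → BV k

data BE (k : ℕ) : BV k → BV k → Set where
  e01 : BE k (c4 zero) (c4 (suc zero))
  e12 : BE k (c4 (suc zero)) (c4 (suc (suc zero)))
  e23 : BE k (c4 (suc (suc zero))) (c4 (suc (suc (suc zero))))
  e30 : BE k (c4 (suc (suc (suc zero)))) (c4 zero)
  sA  : ∀ i → BE k (c4 zero) (leafA i)
  sB  : ∀ i → BE k (c4 (suc (suc zero))) (leafB i)

private
  BE-irr : ∀ {k u} → ¬ BE k u u
  BE-irr ()

Bistar : (k : ℕ) → Graph (BV k)
Bistar k = record
  { E = λ u v → BE k u v ⊎ BE k v u
  ; E-sym = λ { (inj₁ e) → inj₂ e ; (inj₂ e) → inj₁ e }
  ; E-irr = λ { (inj₁ e) → BE-irr e ; (inj₂ e) → BE-irr e } }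

{-# OPTIONS --safe #-}
module Submission where

-- Avoiding. Colour Tr(n) so that (1) both colour classes are bipartite, or (2) there is no monochromatic K₂,₃,
-- or (3) no monochromatic 4-cycle has two adjacent vertices of degree at least 3. A graph with a vertex o at distance
-- at most 2 from all others that is contained in a colour class of each kind is a jellyfish or a bistar: by (1) its
-- edges run between successive distance layers, by (2) and (3) each component left after removing o has at most two
-- neighbours of o, and if it has two and one of them carries a pendant edge then o has no other neighbours.
--
-- Forcing. Inserting vertices repeatedly in the face at an edge xp gives a fan of common neighbours of x and p.
-- Every long fan, with the vertices inserted next to it, contains a monochromatic 4-cycle through x or p.
-- If two vertices of such a cycle that are joined by an edge have few neighbours in its colour, then a fan over that
-- edge gives many common neighbours in the other colour, hence a bistar; otherwise two opposite vertices have many,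
-- again a bistar. For a jellyfish call x pure in a face if all its later neighbours there are joined to x in one colour.
-- If no vertex is pure in any face then monochromatic trees of radius two are everywhere and the 4-cycles in fans supply
-- the flower. If x is pure, then either 4-cycles through x abound or its link contains a jellyfish of the other colour;
-- and if the tree at x is missing then a neighbour p of x is pure in the other colour, and each vertex of the fan over xp
-- has many neighbours in one of the two colours, which yields the tree at x or at p.

open import Defs
open import Data.Bool using (Bool; true; false; not; _xor_; _∧_; _∨_) renaming (_≟_ to _≟ᵇ_)
open import Data.Bool.Properties using (not-¬; not-involutive; xor-comm; xor-same)
open import Data.Empty using (⊥; ⊥-elim)
open import Data.Fin using (Fin; zero; suc; _≟_; _↑ˡ_; _↑ʳ_; splitAt) renaming (_<_ to _<ᶠ_)
open import Data.Fin.Patterns using (0F; 1F; 2F; 3F)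
import Data.Fin.Properties as Fin
open import Data.List using (List; []; _∷_; length)
import Data.List.Properties as List
open import Data.Maybe using (Maybe; just; nothing)
open import Data.Nat using (ℕ; zero; suc; _+_; _*_; _∸_; _≤_; _<_; z≤n; s≤s) renaming (_≟_ to _≟ⁿ_)
open import Data.Nat.Properties hiding (_≟_)
open import Data.Product using (Σ; _×_; _,_; ∃-syntax; proj₁; proj₂)
import Data.Product.Properties as Product
open import Data.Sum using (_⊎_; inj₁; inj₂; [_,_]′) renaming (map to ⊎-map)
import Data.Sum.Properties as Sum
open import Data.Unit using (⊤; tt)
import Data.Unit.Properties as Unit
open import Relation.Binary.Definitions using (tri<; tri≈; tri>)
open import Relation.Binary.PropositionalEquality
open import Relation.Nullary using (¬_; Dec; yes; no; ¬?)
open import Relation.Nullary.Decidable using (_×-dec_; _→-dec_; toWitness; map′)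

-- The infinite iterated triangulation

-- The latest choice of a subface comes first. With addresses all levels share one type of vertices,
-- whereas `Vtx n` nests a sum for each level.
Addr : Set
Addr = List (Fin 3)

Point : Set
Point = Fin 3 ⊎ Addr

new : Addr → Point
new = inj₂

vertexOf : Addr → Fin 3 → Point
vertexOf []      i             = inj₁ i
vertexOf (j ∷ f) zero          = vertexOf f (pick j zero)
vertexOf (j ∷ f) (suc zero)    = vertexOf f (pick j (suc zero))
vertexOf (j ∷ f) (suc (suc _)) = inj₂ f

level : Point → ℕ
level (inj₁ _) = 0
level (inj₂ f) = suc (length f)

level-vertexOf : ∀ f i → level (vertexOf f i) ≤ length f
level-vertexOf []      i             = z≤n
level-vertexOf (j ∷ f) zero          = m≤n⇒m≤1+n (level-vertexOf f _)
level-vertexOf (j ∷ f) (suc zero)    = m≤n⇒m≤1+n (level-vertexOf f _)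
level-vertexOf (j ∷ f) (suc (suc _)) = ≤-refl

data Adj : Point → Point → Set where
  base : ∀ {i j} → i ≢ j → Adj (inj₁ i) (inj₁ j)
  down : ∀ f i → Adj (inj₂ f) (vertexOf f i)
  up   : ∀ f i → Adj (vertexOf f i) (inj₂ f)

Adj-sym : ∀ {u v} → Adj u v → Adj v u
Adj-sym (base p)   = base (λ q → p (sym q))
Adj-sym (down f i) = up f i
Adj-sym (up f i)   = down f i

level<⇒≢ : ∀ {u v} → level u < level v → u ≢ v
level<⇒≢ lt refl = <-irrefl refl lt

Adj⇒≢ : ∀ {u v} → Adj u v → u ≢ v
Adj⇒≢ (base p)   refl = p refl
Adj⇒≢ (down f i) eq   = level<⇒≢ (s≤s (level-vertexOf f i)) (sym eq)
Adj⇒≢ (up f i)   eq   = level<⇒≢ (s≤s (level-vertexOf f i)) eq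

pick-≢ : ∀ j → pick j zero ≢ pick j (suc zero)
pick-≢ 0F ()
pick-≢ 1F ()
pick-≢ 2F ()

vertexOf-Adj : ∀ f {i j} → i ≢ j → Adj (vertexOf f i) (vertexOf f j)
vertexOf-Adj []                      p = base p
vertexOf-Adj (k ∷ f) {0F} {0F} p = ⊥-elim (p refl)
vertexOf-Adj (k ∷ f) {0F} {1F} p = vertexOf-Adj f (pick-≢ k)
vertexOf-Adj (k ∷ f) {0F} {2F} p = up f _
vertexOf-Adj (k ∷ f) {1F} {0F} p = Adj-sym (vertexOf-Adj f (pick-≢ k))
vertexOf-Adj (k ∷ f) {1F} {1F} p = ⊥-elim (p refl)
vertexOf-Adj (k ∷ f) {1F} {2F} p = up f _
vertexOf-Adj (k ∷ f) {2F} {0F} p = down f _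
vertexOf-Adj (k ∷ f) {2F} {1F} p = down f _
vertexOf-Adj (k ∷ f) {2F} {2F} p = ⊥-elim (p refl)

-- Ordering the corners lets a statement single out a corner `x` or an edge `x y` of a face once,
-- instead of for each index.
data Tri (f : Addr) : Point → Point → Point → Set where
  t012 : Tri f (vertexOf f 0F) (vertexOf f 1F) (vertexOf f 2F)
  t021 : Tri f (vertexOf f 0F) (vertexOf f 2F) (vertexOf f 1F)
  t102 : Tri f (vertexOf f 1F) (vertexOf f 0F) (vertexOf f 2F)
  t120 : Tri f (vertexOf f 1F) (vertexOf f 2F) (vertexOf f 0F)
  t201 : Tri f (vertexOf f 2F) (vertexOf f 0F) (vertexOf f 1F)
  t210 : Tri f (vertexOf f 2F) (vertexOf f 1F) (vertexOf f 0F)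

variable
  f g : Addr
  n D D′ : ℕ
  u v w x y z : Point

swapˡ : Tri f x y z → Tri f y x z
swapˡ t012 = t102
swapˡ t021 = t201
swapˡ t102 = t012
swapˡ t120 = t210
swapˡ t201 = t021
swapˡ t210 = t120

swapʳ : Tri f x y z → Tri f x z y
swapʳ t012 = t021
swapʳ t021 = t012
swapʳ t102 = t120
swapʳ t120 = t102
swapʳ t201 = t210
swapʳ t210 = t201

side : Tri f x y z → Fin 3
side t012 = 0F
side t021 = 2F
side t102 = 0F
side t120 = 1F
side t201 = 2F
side t210 = 1F

sub : (T : Tri f x y z) → Tri (side T ∷ f) x y (inj₂ f)
sub t012 = t012
sub t021 = t012
sub t102 = t102
sub t120 = t012
sub t201 = t102
sub t210 = t102

side-swapˡ : (T : Tri f x y z) → side (swapˡ T) ≡ side T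
side-swapˡ t012 = refl
side-swapˡ t021 = refl
side-swapˡ t102 = refl
side-swapˡ t120 = refl
side-swapˡ t201 = refl
side-swapˡ t210 = refl

side-≢ : (T : Tri f x y z) → side T ≢ side (swapʳ T)
side-≢ t012 ()
side-≢ t021 ()
side-≢ t102 ()
side-≢ t120 ()
side-≢ t201 ()
side-≢ t210 ()

tri-vertex : Tri f x y z → ∃[ i ] vertexOf f i ≡ x
tri-vertex t012 = 0F , refl
tri-vertex t021 = 0F , refl
tri-vertex t102 = 1F , refl
tri-vertex t120 = 1F , refl
tri-vertex t201 = 2F , refl
tri-vertex t210 = 2F , refl

spoke : Tri f x y z → Adj x (inj₂ f)
spoke {f} T with tri-vertex T
... | i , refl = up f i

rim : Tri f x y z → Adj x y
rim {f} t012 = vertexOf-Adj f λ ()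
rim {f} t021 = vertexOf-Adj f λ ()
rim {f} t102 = vertexOf-Adj f λ ()
rim {f} t120 = vertexOf-Adj f λ ()
rim {f} t201 = vertexOf-Adj f λ ()
rim {f} t210 = vertexOf-Adj f λ ()

tri-level : Tri f x y z → level x ≤ length f
tri-level {f} T with tri-vertex T
... | i , refl = level-vertexOf f i

-- Corners are excluded and depth 0 is empty, so everything inside a face has a higher level than
-- its corners.
data Inside : Addr → ℕ → Point → Set where
  centre : Inside f (suc n) (inj₂ f)
  deeper : ∀ j → Inside (j ∷ f) n v → Inside f (suc n) v

inside-mono : D ≤ D′ → Inside f D v → Inside f D′ v
inside-mono (s≤s p) centre       = centre
inside-mono (s≤s p) (deeper j i) = deeper j (inside-mono p i)

inside-level> : Inside f D v → length f < level v
inside-level> centre       = ≤-refl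
inside-level> (deeper j i) = <-trans (n<1+n _) (inside-level> i)

inside-level≤ : Inside f D v → level v ≤ D + length f
inside-level≤ {f} {suc n} centre = s≤s (m≤n+m _ n)
inside-level≤ {f} {suc n} (deeper j i) = ≤-trans (inside-level≤ i) (≤-reflexive (+-suc n (length f)))

tri-≢-inside : Tri f x y z → Inside f D v → x ≢ v
tri-≢-inside T i = level<⇒≢ (≤-<-trans (tri-level T) (inside-level> i))

tri-≢-centre : Tri f x y z → x ≢ inj₂ f
tri-≢-centre T = tri-≢-inside T (centre {n = 0})

-- Passing again and again to the subface that keeps the edge `x y` makes the inserted vertices
-- `new (fanAddr T n)` common neighbours of `x` and `y`, each joined to the next: the fan over
-- `x y`.
fanAddr : Tri f x y z → ℕ → Addr
fanAddr {f} T zero    = f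
fanAddr     T (suc n) = fanAddr (sub T) n

fanLast : Tri f x y z → ℕ → Point
fanLast {z = z} T zero    = z
fanLast         T (suc n) = fanLast (sub T) n

fan : (T : Tri f x y z) → ∀ n → Tri (fanAddr T n) x y (fanLast T n)
fan T zero    = T
fan T (suc n) = fan (sub T) n

length-fan : (T : Tri f x y z) → ∀ n → length (fanAddr T n) ≡ n + length f
length-fan T zero    = refl
length-fan {f} T (suc n) = trans (length-fan (sub T) n) (+-suc n (length f))

fan-inside : (T : Tri f x y z) → ∀ n → Inside (fanAddr T n) D v → Inside f (n + D) v
fan-inside T zero    i = i
fan-inside T (suc n) i = deeper _ (fan-inside (sub T) n i)

-- Levels separate the two: depth `D` inside `f` reaches level at most `D + length f`, and whatever
-- is inserted in the `D`-th face of the fan lies above that. Disjointness along a fan rests on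
-- this.
inside-fan-≢ : (T : Tri f x y z) → Inside f D v → Inside (fanAddr T D) D′ w → v ≢ w
inside-fan-≢ {f} {D = D} T i j =
  level<⇒≢ (≤-<-trans (≤-trans (inside-level≤ i) (≤-reflexive (sym (length-fan T D)))) (inside-level> j))

-- Disjoint configurations along a fan

Throughout : (Point → Set) → Addr → ℕ → Set
Throughout R f n = ∀ {v} → Inside f n v → R v

Placed : (U : Set) → ((U → Point) → Set) → Addr → ℕ → Set
Placed U P f n = Σ (U → Point) λ e → P e × (∀ a → Inside f n (e a))

-- `disjoint` separates different copies only; injectivity of a single copy, where wanted, is part
-- of `P`.
record Placedⁿ (U : Set) (P : (U → Point) → Set) (k : ℕ) (f : Addr) (n : ℕ) : Set where
  field
    at       : Fin k → U → Point
    holds    : ∀ i → P (at i)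
    inside   : ∀ i a → Inside f n (at i a)
    disjoint : ∀ {i j a b} → at i a ≡ at j b → i ≡ j
open Placedⁿ

-- The fan over `x y` is cut into `k` blocks of `D` levels and `place` is run in each. `Q` is an
-- outcome that ends the search at once.
collect : {U Q : Set} {P : (U → Point) → Set} {R : Point → Set} {D : ℕ} →
  (∀ {f z} → Tri f x y z → Throughout R f D → Q ⊎ Placed U P f D) →
  ∀ k {f z} → Tri f x y z → Throughout R f (k * D) → Q ⊎ Placedⁿ U P k f (k * D)
collect place zero T h = inj₂ record { at = λ () ; holds = λ () ; inside = λ () ; disjoint = λ { {()} } }
collect {x = x} {y} {U} {Q} {P} {D = D} place (suc k) {f} T h
  with place T (λ i → h (inside-mono (m≤m+n D (k * D)) i))
     | collect place k (fan T D) (λ i → h (fan-inside T D i))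
... | inj₁ q | _ = inj₁ q
... | inj₂ _ | inj₁ q = inj₁ q
... | inj₂ (e , p , i) | inj₂ r = inj₂ record { at = at′ ; holds = holds′ ; inside = inside′ ; disjoint = λ {i} {j} → disjoint′ i j }
  where
    at′ : Fin (suc k) → U → Point
    at′ zero    = e
    at′ (suc i) = at r i
    holds′ : ∀ i → P (at′ i)
    holds′ zero    = p
    holds′ (suc i) = holds r i
    inside′ : ∀ i a → Inside f (D + k * D) (at′ i a)
    inside′ zero    a = inside-mono (m≤m+n D (k * D)) (i a)
    inside′ (suc j) a = fan-inside T D (inside r j a)
    disjoint′ : ∀ i j {a b} → at′ i a ≡ at′ j b → i ≡ j
    disjoint′ zero    zero    eq = refl
    disjoint′ zero    (suc j) eq = ⊥-elim (inside-fan-≢ T (i _) (inside r j _) eq)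
    disjoint′ (suc i′) zero    eq = ⊥-elim (inside-fan-≢ T (i _) (inside r i′ _) (sym eq))
    disjoint′ (suc i′) (suc j) eq = cong suc (disjoint r eq)

third : Tri f x y z → Tri f z x y
third T = swapˡ (swapʳ T)

Selection : {t : ℕ} → ℕ → (Fin t → Set) → Set
Selection {t} m A = Σ (Fin m → Fin t) λ s → (∀ {i j} → s i ≡ s j → i ≡ j) × (∀ i → A (s i))

skip : ∀ {t m} {A : Fin (suc t) → Set} → Selection m (λ i → A (suc i)) → Selection m A
skip (s , inj , h) = (λ i → suc (s i)) , (λ eq → inj (Fin.suc-injective eq)) , h

take : ∀ {t m} {A : Fin (suc t) → Set} → A zero → Selection m (λ i → A (suc i)) → Selection (suc m) A
take {t} {m} {A} a (s , inj , h) = s′ , (λ {i} {j} → inj′ i j) , h′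
  where
    s′ : Fin (suc m) → Fin (suc t)
    s′ zero    = zero
    s′ (suc i) = suc (s i)
    inj′ : ∀ i j → s′ i ≡ s′ j → i ≡ j
    inj′ zero    zero    eq = refl
    inj′ (suc i) (suc j) eq = cong suc (inj (Fin.suc-injective eq))
    h′ : ∀ i → A (s′ i)
    h′ zero    = a
    h′ (suc i) = h i

pigeonhole : ∀ m n {t} {A B : Fin t → Set} → m + n ≤ t →
  (∀ i → A i ⊎ B i) → Selection m A ⊎ Selection n B
pigeonhole zero    n    p h = inj₁ ((λ ()) , (λ { {()} }) , λ ())
pigeonhole (suc m) zero p h = inj₂ ((λ ()) , (λ { {()} }) , λ ())
pigeonhole (suc m) (suc n) {suc t} {A} {B} (s≤s p) h with h zero
... | inj₁ a = ⊎-map (take {A = A} a) (skip {A = B}) (pigeonhole m (suc n) p (λ i → h (suc i)))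
... | inj₂ b = ⊎-map (skip {A = A}) (take {A = B} b)
                 (pigeonhole (suc m) n (≤-trans (≤-reflexive (sym (+-suc m n))) p) (λ i → h (suc i)))

split : ∀ {U : Set} {P Q : (U → Point) → Set} m k {f n} →
  Placedⁿ U (λ e → P e ⊎ Q e) (m + k) f n → Placedⁿ U P m f n ⊎ Placedⁿ U Q k f n
split m k r = ⊎-map select select (pigeonhole m k ≤-refl (holds r))
  where
    select : ∀ {l R} → Selection l (λ i → R (at r i)) → Placedⁿ _ R l _ _
    select (s , inj , h) = record
      { at = λ i → at r (s i) ; holds = h ; inside = λ i → inside r (s i)
      ; disjoint = λ eq → inj (disjoint r eq) }

-- Here `place` may also stumble on a bad vertex, but two distinct bad vertices give `Q`. After a
-- first one, the search restarts in the next `k * D` levels, where any bad vertex differs from the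
-- first and clashes with it.
collect₂ : {U Q : Set} {P : (U → Point) → Set} {R B : Point → Set} {D : ℕ} →
  (∀ {v w} → B v → B w → v ≢ w → Q) →
  (∀ {f z} → Tri f x y z → Throughout R f D → Q ⊎ (∃[ v ] Inside f D v × B v) ⊎ Placed U P f D) →
  ∀ k {f z} → Tri f x y z → Throughout R f (k * D + k * D) → Q ⊎ Placedⁿ U P k f (k * D + k * D)
collect₂ {x} {y} {U} {Q} {P} {R} {B} {D} clash place k {f} T h =
  [ first , (λ r → inj₂ (weaken (λ i → inside-mono (m≤m+n _ _) i) r)) ]′
    (collect place₁ k T (λ i → h (inside-mono (m≤m+n _ _) i) , i))
  where
    weaken : ∀ {m g} → (∀ {v} → Inside g m v → Inside f (k * D + k * D) v) →
      Placedⁿ U P k g m → Placedⁿ U P k f (k * D + k * D)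
    weaken w r = record { at = at r ; holds = holds r ; inside = λ i a → w (inside r i a) ; disjoint = disjoint r }
    Q₁ : Set
    Q₁ = Q ⊎ ∃[ v ] Inside f (k * D) v × B v
    place₁ : ∀ {g z} → Tri g x y z → Throughout (λ v → R v × Inside f (k * D) v) g D → Q₁ ⊎ Placed U P g D
    place₁ S h₁ with place S (λ i → proj₁ (h₁ i))
    ... | inj₁ q = inj₁ (inj₁ q)
    ... | inj₂ (inj₁ (v , i , bv)) = inj₁ (inj₂ (v , proj₂ (h₁ i) , bv))
    ... | inj₂ (inj₂ p) = inj₂ p
    first : Q₁ → Q ⊎ Placedⁿ U P k f (k * D + k * D)
    first (inj₁ q) = inj₁ q
    first (inj₂ (v , i , bv)) =
      ⊎-map (λ q → q) (weaken (fan-inside T (k * D)))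
        (collect place₂ k (fan T (k * D)) (λ j → h (fan-inside T (k * D) j) , inside-fan-≢ T i j))
      where
        place₂ : ∀ {g z} → Tri g x y z → Throughout (λ w → R w × v ≢ w) g D → Q ⊎ Placed U P g D
        place₂ S h₂ with place S (λ j → proj₁ (h₂ j))
        ... | inj₁ q = inj₁ q
        ... | inj₂ (inj₁ (w , j , bw)) = inj₁ (clash bv bw (proj₂ (h₂ j)))
        ... | inj₂ (inj₂ p) = inj₂ p

-- Monochromatic 4-cycles in a fan

colour? : ∀ b d → d ≡ b ⊎ d ≡ not b
colour? false false = inj₁ refl
colour? false true  = inj₂ refl
colour? true  false = inj₂ refl
colour? true  true  = inj₁ refl

_≟ᴾ_ : (u v : Point) → Dec (u ≡ v)
_≟ᴾ_ = Sum.≡-dec Fin._≟_ (List.≡-dec Fin._≟_)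

module Coloured (c : Point → Point → Bool) (c-sym : ∀ u v → c u v ≡ c v u) where

  Edge : Bool → Point → Point → Set
  Edge b u v = Adj u v × c u v ≡ b

  flip : ∀ {b} → Edge b u v → Edge b v u
  flip (e , p) = Adj-sym e , trans (c-sym _ _) p

  Edge⇒≢ : ∀ {b} → Edge b u v → u ≢ v
  Edge⇒≢ (e , _) = Adj⇒≢ e

  edge? : ∀ b → Adj u v → Edge b u v ⊎ Edge (not b) u v
  edge? b e = ⊎-map (e ,_) (e ,_) (colour? b _)

  IsPetal : Bool → Point → (Fin 3 → Point) → Set
  IsPetal b x e = Edge b x (e 0F) × Edge b (e 0F) (e 1F) × Edge b (e 1F) (e 2F) × Edge b (e 2F) x
    × (∀ {i j} → e i ≡ e j → i ≡ j)

  Petal : Bool → Point → (Point → Set) → Set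
  Petal b x In = Σ (Fin 3 → Point) λ e → IsPetal b x e × (∀ i → In (e i))

  mkPetal : ∀ {b x a₁ a₂ a₃ In} → Edge b x a₁ → Edge b a₁ a₂ → Edge b a₂ a₃ → Edge b a₃ x → a₁ ≢ a₃ →
    In a₁ → In a₂ → In a₃ → Petal b x In
  mkPetal {b} {x} {a₁} {a₂} {a₃} {In} e₁ e₂ e₃ e₄ ne i₁ i₂ i₃ = e , (e₁ , e₂ , e₃ , e₄ , λ {i} {j} → inj i j) , ins
    where
      e : Fin 3 → Point
      e 0F = a₁
      e 1F = a₂
      e 2F = a₃
      inj : ∀ i j → e i ≡ e j → i ≡ j
      inj 0F 0F eq = refl
      inj 0F 1F eq = ⊥-elim (Edge⇒≢ e₂ eq)
      inj 0F 2F eq = ⊥-elim (ne eq)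
      inj 1F 0F eq = ⊥-elim (Edge⇒≢ e₂ (sym eq))
      inj 1F 1F eq = refl
      inj 1F 2F eq = ⊥-elim (Edge⇒≢ e₃ eq)
      inj 2F 0F eq = ⊥-elim (ne (sym eq))
      inj 2F 1F eq = ⊥-elim (Edge⇒≢ e₃ (sym eq))
      inj 2F 2F eq = refl
      ins : ∀ i → In (e i)
      ins 0F = i₁
      ins 1F = i₂
      ins 2F = i₃

  data OnCycle (b : Bool) (x p : Point) (In : Point → Set) : Set where
    cycle : ∀ {a₁ a₂ a₃} → Edge b x a₁ → Edge b a₁ a₂ → Edge b a₂ a₃ → Edge b a₃ x → a₁ ≢ a₃ → x ≢ a₂ →
      In a₁ ⊎ a₁ ≡ p → In a₂ ⊎ a₂ ≡ p → In a₃ ⊎ a₃ ≡ p → OnCycle b x p In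

  Cycle : Point → Point → (Point → Set) → Set
  Cycle x p In = ∃[ b ] OnCycle b x p In

  -- `r` is the colour of the edge `x p` and `b` the other one. A fan vertex that sees `x` and `p`
  -- in different colours is of kind `X` or `P`, after the end it sees in colour `r`. Each lemma
  -- treats one assignment of kinds; exchanging `x` and `p` gives the other.
  module Half {In : Point → Set} {x p : Point} {r b : Bool} (two : ∀ d → d ≡ r ⊎ d ≡ b)
              (xp : Edge r x p) where

    Res : Set
    Res = Cycle x p In ⊎ Cycle p x In

    cyc : ∀ {b a₁ a₂ a₃} → Edge b x a₁ → Edge b a₁ a₂ → Edge b a₂ a₃ → Edge b a₃ x → a₁ ≢ a₃ → x ≢ a₂ →
      In a₁ ⊎ a₁ ≡ p → In a₂ ⊎ a₂ ≡ p → In a₃ ⊎ a₃ ≡ p → Res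
    cyc e₁ e₂ e₃ e₄ n₁ n₂ i₁ i₂ i₃ = inj₁ (_ , cycle e₁ e₂ e₃ e₄ n₁ n₂ i₁ i₂ i₃)

    cycᵖ : ∀ {b a₁ a₂ a₃} → Edge b p a₁ → Edge b a₁ a₂ → Edge b a₂ a₃ → Edge b a₃ p → a₁ ≢ a₃ → p ≢ a₂ →
      In a₁ → In a₂ → In a₃ → Res
    cycᵖ e₁ e₂ e₃ e₄ n₁ n₂ i₁ i₂ i₃ = inj₂ (_ , cycle e₁ e₂ e₃ e₄ n₁ n₂ (inj₁ i₁) (inj₁ i₂) (inj₁ i₃))

    to? : Adj u v → Edge r u v ⊎ Edge b u v
    to? e = ⊎-map (e ,_) (e ,_) (two _)

    X P : Point → Set
    X q = Edge r x q × Edge b p q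
    P q = Edge b x q × Edge r p q

    -- q and q′ stand for consecutive vertices of the fan over the edge xp.
    module _ {g q} (T : Tri g x p q) (iq : In q) (h : Throughout In g 2) where
      private
        q′ : Point
        q′ = inj₂ g
        iq′ : In q′
        iq′ = h centre
        U : Tri (side (swapʳ T) ∷ g) x q q′
        U = sub (swapʳ T)
        m : Point
        m = inj₂ (side (swapʳ T) ∷ g)
        im : In m
        im = h (deeper _ centre)
        xm : Adj x m
        xm = spoke U
        qm : Adj q m
        qm = spoke (swapˡ U)
        q′m : Adj q′ m
        q′m = spoke (third U)
        x≢q : x ≢ q
        x≢q = Adj⇒≢ (rim (swapʳ T))
        x≢q′ : x ≢ q′
        x≢q′ = tri-≢-centre T
        x≢m : x ≢ m
        x≢m = tri-≢-centre U
        p≢m : p ≢ m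
        p≢m = tri-≢-inside (swapˡ T) (deeper _ (centre {n = 0}))
        p≢q : p ≢ q
        p≢q = Adj⇒≢ (rim (swapʳ (swapˡ T)))
        p≢q′ : p ≢ q′
        p≢q′ = tri-≢-centre (swapˡ T)
        q≢q′ : q ≢ q′
        q≢q′ = tri-≢-centre (third T)

      -- Colour `r` contains a path from `x` to `p` through `q` and `q′`, which the edge `x p`
      -- closes.
      change : X q × P q′ ⊎ P q × X q′ → Edge r q q′ → Res
      change (inj₁ ((xq , _) , (_ , pq′))) e =
        cyc xq e (flip pq′) (flip xp) (λ eq → p≢q (sym eq)) x≢q′ (inj₁ iq) (inj₁ iq′) (inj₂ refl)
      change (inj₂ ((_ , pq) , (xq′ , _))) e =
        cyc xq′ (flip e) (flip pq) (flip xp) (λ eq → p≢q′ (sym eq)) x≢q (inj₁ iq′) (inj₁ iq) (inj₂ refl)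

      -- The vertex `m` inserted in the triangle `x q q′` sends out three edges in two colours, so
      -- two of them agree, and each of the six ways to agree closes a 4-cycle.
      equal : P q → P q′ → Edge b q q′ → Res
      equal (xq , pq) (xq′ , pq′) e with to? xm | to? qm | to? q′m
      ... | inj₂ xm | inj₂ qm | _ =
        cyc xm (flip qm) e (flip xq′) (λ eq → Adj⇒≢ (spoke (third U)) (sym eq)) x≢q (inj₁ im) (inj₁ iq) (inj₁ iq′)
      ... | inj₂ xm | inj₁ _ | inj₂ q′m =
        cyc xm (flip q′m) (flip e) (flip xq) (λ eq → Adj⇒≢ (spoke (swapˡ U)) (sym eq)) x≢q′ (inj₁ im) (inj₁ iq′) (inj₁ iq)
      ... | inj₂ _ | inj₁ qm | inj₁ q′m = cycᵖ pq qm (flip q′m) (flip pq′) q≢q′ p≢m iq im iq′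
      ... | inj₁ xm | inj₁ qm | _ =
        cyc xp pq qm (flip xm) p≢m x≢q (inj₂ refl) (inj₁ iq) (inj₁ im)
      ... | inj₁ xm | inj₂ _ | inj₁ q′m =
        cyc xp pq′ q′m (flip xm) p≢m x≢q′ (inj₂ refl) (inj₁ iq′) (inj₁ im)
      ... | inj₁ _ | inj₂ qm | inj₂ q′m = cyc xq qm (flip q′m) (flip xq′) q≢q′ x≢m (inj₁ iq) (inj₁ im) (inj₁ iq′)

      -- q₀ q q′ q₃ are consecutive in the fan.
      flanked : ∀ {q₀ q₃} → In q₀ → In q₃ → q₀ ≢ m → q₃ ≢ m → P q₀ → X q → X q′ → P q₃ →
        Edge b q₀ q → Edge r q q′ → Edge b q′ q₃ → Res
      flanked i₀ i₃ n₀ n₃ (xq₀ , _) (xq , pq) (xq′ , pq′) (xq₃ , _) e₀ e e₃ with to? xm | to? qm | to? q′m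
      ... | inj₁ xm | inj₁ qm | _ =
        cyc xm (flip qm) e (flip xq′) (λ eq → Adj⇒≢ (spoke (third U)) (sym eq)) x≢q (inj₁ im) (inj₁ iq) (inj₁ iq′)
      ... | inj₁ xm | inj₂ _ | inj₁ q′m =
        cyc xm (flip q′m) (flip e) (flip xq) (λ eq → Adj⇒≢ (spoke (swapˡ U)) (sym eq)) x≢q′ (inj₁ im) (inj₁ iq′) (inj₁ iq)
      ... | inj₁ _ | inj₂ qm | inj₂ q′m = cycᵖ pq qm (flip q′m) (flip pq′) q≢q′ p≢m iq im iq′
      ... | inj₂ xm | inj₂ qm | _ = cyc xq₀ e₀ qm (flip xm) n₀ x≢q (inj₁ i₀) (inj₁ iq) (inj₁ im)
      ... | inj₂ xm | inj₁ _ | inj₂ q′m = cyc xq₃ (flip e₃) q′m (flip xm) n₃ x≢q′ (inj₁ i₃) (inj₁ iq′) (inj₁ im)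
      ... | inj₂ _ | inj₁ qm | inj₁ q′m = cyc xq qm (flip q′m) (flip xq′) q≢q′ x≢m (inj₁ iq) (inj₁ im) (inj₁ iq′)

    -- Unless `equal` or `change` applies, the two edges at the middle vertex have colour `r` if it
    -- is of kind `P`, closing a cycle through `p`, and colour `b` if it is of kind `X`, closing one
    -- through `x`.
    samePoles : ∀ {g g′ q₀} (T₁ : Tri g x p q₀) (T₂ : Tri g′ x p (inj₂ g)) →
      In q₀ → Throughout In g 2 → Throughout In g′ 2 → q₀ ≢ inj₂ g′ →
      P q₀ → X (inj₂ g) ⊎ P (inj₂ g) → P (inj₂ g′) → Res
    samePoles T₁ T₂ i₀ h₁ h₂ ne P₀ t₁ P₂ with to? (spoke (third T₁)) | to? (spoke (third T₂)) | t₁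
    ... | inj₂ e₁ | _       | inj₂ P₁ = equal T₁ i₀ h₁ P₀ P₁ e₁
    ... | inj₁ e₁ | _       | inj₁ X₁ = change T₁ i₀ h₁ (inj₂ (P₀ , X₁)) e₁
    ... | _       | inj₂ e₂ | inj₂ P₁ = equal T₂ (h₁ centre) h₂ P₁ P₂ e₂
    ... | _       | inj₁ e₂ | inj₁ X₁ = change T₂ (h₁ centre) h₂ (inj₁ (X₁ , P₂)) e₂
    ... | inj₁ e₁ | inj₁ e₂ | inj₂ P₁ =
      cycᵖ (proj₂ P₀) e₁ e₂ (flip (proj₂ P₂)) ne (tri-≢-centre (swapˡ T₁)) i₀ (h₁ centre) (h₂ centre)
    ... | inj₂ e₁ | inj₂ e₂ | inj₁ X₁ =
      cyc (proj₁ P₀) e₁ e₂ (flip (proj₁ P₂)) ne (tri-≢-centre T₁) (inj₁ i₀) (inj₁ (h₁ centre)) (inj₁ (h₂ centre))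

    -- By `change` the outer two of the three edges along the fan may be taken to have colour `b`,
    -- and by `unequal` the middle one to have colour `r`; this is the situation of `flanked`. The
    -- argument `unequal` will be `equal` with `x` and `p` exchanged.
    flankedPair : ∀ {f g g′ q₀} (T₁ : Tri f x p q₀) (T₂ : Tri g x p (inj₂ f)) (T₃ : Tri g′ x p (inj₂ g)) →
      In q₀ → Throughout In f 2 → Throughout In g 2 → Throughout In g′ 2 →
      q₀ ≢ new (side (swapʳ T₂) ∷ g) → new g′ ≢ new (side (swapʳ T₂) ∷ g) →
      P q₀ → X (inj₂ f) → X (inj₂ g) → P (inj₂ g′) → (Edge b (inj₂ f) (inj₂ g) → Res) → Res
    flankedPair T₁ T₂ T₃ i₀ h₁ h₂ h₃ n₀ n₃ P₀ X₁ X₂ P₃ unequal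
      with to? (spoke (third T₁)) | to? (spoke (third T₂)) | to? (spoke (third T₃))
    ... | inj₁ e₁ | _ | _ = change T₁ i₀ h₁ (inj₂ (P₀ , X₁)) e₁
    ... | _ | inj₂ e₂ | _ = unequal e₂
    ... | _ | _ | inj₁ e₃ = change T₃ (h₂ centre) h₃ (inj₁ (X₂ , P₃)) e₃
    ... | inj₂ e₁ | inj₁ e₂ | inj₂ e₃ =
      flanked T₂ (h₁ centre) h₂ i₀ (h₃ centre) n₀ n₃ P₀ X₁ X₂ P₃ e₁ e₂ e₃

  module Fan {In : Point → Set} {x p : Point} {r b : Bool} (two : ∀ d → d ≡ r ⊎ d ≡ b) (xp : Edge r x p) where
    open Half {In} two xp
    private module Swapped = Half {In} two (flip xp)

    swap : {A B : Set} → A ⊎ B → B ⊎ A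
    swap = [ inj₂ , inj₁ ]′

    flipped : ∀ {q} → X q → Swapped.P q
    flipped (e , d) = d , e

    flipped′ : ∀ {q} → P q → Swapped.X q
    flipped′ (e , d) = d , e

    -- If two vertices at distance two along the fan have the same kind, `samePoles` applies.
    -- Otherwise the kinds come in pairs, and among five consecutive vertices some pair is flanked
    -- on both sides by the other kind.
    mixed⁵ : ∀ {f t} (T : Tri f x p t) → Throughout In f 6 →
      let q = λ n → new (fanAddr T n) in
      X (q 0) ⊎ P (q 0) → X (q 1) ⊎ P (q 1) → X (q 2) ⊎ P (q 2) → X (q 3) ⊎ P (q 3) → X (q 4) ⊎ P (q 4) → Res
    mixed⁵ {f} T h = go
      where
        q : ℕ → Point
        q n = new (fanAddr T n)
        h₁ : Throughout In (fanAddr T 1) 5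
        h₁ i = h (deeper _ i)
        h₂ : Throughout In (fanAddr T 2) 4
        h₂ i = h₁ (deeper _ i)
        h₃ : Throughout In (fanAddr T 3) 3
        h₃ i = h₂ (deeper _ i)
        h₄ : Throughout In (fanAddr T 4) 2
        h₄ i = h₃ (deeper _ i)
        h₂³ : Throughout In (fanAddr T 2) 3
        h₂³ i = h₂ (inside-mono (n≤1+n _) i)
        2≤ : ∀ {n g} → Throughout In g (2 + n) → Throughout In g 2
        2≤ h i = h (inside-mono (s≤s (s≤s z≤n)) i)
        apart : ∀ n → q n ≢ q (2 + n)
        apart n = level<⇒≢ (subst₂ _<_ (sym (cong suc (length-fan T n))) (sym (cong suc (length-fan T (2 + n))))
                             (s≤s (s≤s (n≤1+n _))))
        samePole : ∀ {g g′ q₀} (T₁ : Tri g x p q₀) (T₂ : Tri g′ x p (inj₂ g)) →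
          In q₀ → Throughout In g 2 → Throughout In g′ 2 → q₀ ≢ inj₂ g′ →
          X q₀ × X (inj₂ g′) ⊎ P q₀ × P (inj₂ g′) → X (inj₂ g) ⊎ P (inj₂ g) → Res
        samePole T₁ T₂ i₀ h₁ h₂ ne (inj₂ (P₀ , P₂)) t₁ = samePoles T₁ T₂ i₀ h₁ h₂ ne P₀ t₁ P₂
        samePole T₁ T₂ i₀ h₁ h₂ ne (inj₁ (X₀ , X₂)) t₁ =
          swap (Swapped.samePoles (swapˡ T₁) (swapˡ T₂) i₀ h₁ h₂ ne (flipped X₀)
                 (swap (⊎-map flipped flipped′ t₁)) (flipped X₂))
        same₀ : X (q 0) × X (q 2) ⊎ P (q 0) × P (q 2) → X (q 1) ⊎ P (q 1) → Res
        same₀ = samePole (fan T 1) (fan T 2) (h centre) (2≤ h₁) (2≤ h₂) (apart 0)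
        same₁ : X (q 1) × X (q 3) ⊎ P (q 1) × P (q 3) → X (q 2) ⊎ P (q 2) → Res
        same₁ = samePole (fan T 2) (fan T 3) (h₁ centre) (2≤ h₂) (2≤ h₃) (apart 1)
        same₂ : X (q 2) × X (q 4) ⊎ P (q 2) × P (q 4) → X (q 3) ⊎ P (q 3) → Res
        same₂ = samePole (fan T 3) (fan T 4) (h₂ centre) (2≤ h₃) (2≤ h₄) (apart 2)
        flank : ∀ {f g q₀} (T₁ : Tri f x p q₀) (T₂ : Tri g x p (inj₂ f)) →
          In q₀ → Throughout In f 2 → Throughout In g 3 →
          X q₀ × P (inj₂ f) × P (inj₂ g) × X (new (side T₂ ∷ g)) ⊎ P q₀ × X (inj₂ f) × X (inj₂ g) × P (new (side T₂ ∷ g)) → Res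
        flank {f} {g} {q₀} T₁ T₂ i₀ h₁ h₂ t = [ poleX , poleP ]′ t
          where
            older : ∀ {j} → q₀ ≢ new (j ∷ g)
            older = level<⇒≢ (s≤s (≤-trans (tri-level (third T₁))
                      (≤-trans (n≤1+n _) (≤-trans (tri-level (third T₂)) (n≤1+n _)))))
            siblings : ∀ {i j} → i ≢ j → new (i ∷ g) ≢ new (j ∷ g)
            siblings ne refl = ne refl
            h₂′ : Throughout In g 2
            h₂′ = 2≤ h₂
            h₂⁺ : Throughout In (side T₂ ∷ g) 2
            h₂⁺ i = h₂ (deeper _ i)
            poleP : P q₀ × X (inj₂ f) × X (inj₂ g) × P (new (side T₂ ∷ g)) → Res
            poleP (P₀ , X₁ , X₂ , P₃) =
              flankedPair T₁ T₂ (sub T₂) i₀ h₁ h₂′ h₂⁺ older (siblings (side-≢ T₂)) P₀ X₁ X₂ P₃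
                (λ e → swap (Swapped.equal (swapˡ T₂) (h₁ centre) h₂′ (flipped X₁) (flipped X₂) e))
            poleX : X q₀ × P (inj₂ f) × P (inj₂ g) × X (new (side T₂ ∷ g)) → Res
            poleX (X₀ , P₁ , P₂ , X₃) =
              swap (Swapped.flankedPair (swapˡ T₁) (swapˡ T₂) (swapˡ (sub T₂)) i₀ h₁ h₂′ h₂⁺ older
                (siblings (λ eq → side-≢ (swapˡ T₂) (trans (side-swapˡ T₂) eq)))
                (flipped X₀) (flipped′ P₁) (flipped′ P₂) (flipped X₃)
                (λ e → swap (equal T₂ (h₁ centre) h₂′ P₁ P₂ e)))
        go : X (q 0) ⊎ P (q 0) → X (q 1) ⊎ P (q 1) → X (q 2) ⊎ P (q 2) → X (q 3) ⊎ P (q 3) → X (q 4) ⊎ P (q 4) → Res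
        go (inj₁ a) t (inj₁ b) _ _ = same₀ (inj₁ (a , b)) t
        go (inj₂ a) t (inj₂ b) _ _ = same₀ (inj₂ (a , b)) t
        go _ (inj₁ a) t (inj₁ b) _ = same₁ (inj₁ (a , b)) t
        go _ (inj₂ a) t (inj₂ b) _ = same₁ (inj₂ (a , b)) t
        go _ _ (inj₁ a) t (inj₁ b) = same₂ (inj₁ (a , b)) t
        go _ _ (inj₂ a) t (inj₂ b) = same₂ (inj₂ (a , b)) t
        go (inj₁ a) (inj₂ b) (inj₂ c) (inj₁ d) (inj₁ _) =
          flank (fan T 1) (fan T 2) (h centre) (2≤ h₁) h₂³ (inj₁ (a , b , c , d))
        go (inj₂ a) (inj₁ b) (inj₁ c) (inj₂ d) (inj₂ _) =
          flank (fan T 1) (fan T 2) (h centre) (2≤ h₁) h₂³ (inj₂ (a , b , c , d))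
        go (inj₁ _) (inj₁ a) (inj₂ b) (inj₂ c) (inj₁ d) =
          flank (fan T 2) (fan T 3) (h₁ centre) (2≤ h₂) h₃ (inj₁ (a , b , c , d))
        go (inj₂ _) (inj₂ a) (inj₁ b) (inj₁ c) (inj₂ d) =
          flank (fan T 2) (fan T 3) (h₁ centre) (2≤ h₂) h₃ (inj₂ (a , b , c , d))

    Mono : Point → Set
    Mono q = Edge r x q × Edge r p q ⊎ Edge b x q × Edge b p q

    mono⁵ : ∀ {f t} (T : Tri f x p t) → Throughout In f 6 → Res ⊎ ∃[ q ] Inside f 6 q × Mono q
    mono⁵ {f} T h = go (type 0) (type 1) (type 2) (type 3) (type 4)
      where
        q : ℕ → Point
        q n = new (fanAddr T n)
        i : ∀ {n} → n < 6 → Inside f 6 (q n)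
        i {n} lt = inside-mono (≤-trans (≤-reflexive (+-comm n 1)) lt) (fan-inside T n (centre {n = 0}))
        type : ∀ n → Mono (q n) ⊎ X (q n) ⊎ P (q n)
        type n with to? (spoke (fan T n)) | to? (spoke (swapˡ (fan T n)))
        ... | inj₁ e | inj₁ d = inj₁ (inj₁ (e , d))
        ... | inj₁ e | inj₂ d = inj₂ (inj₁ (e , d))
        ... | inj₂ e | inj₁ d = inj₂ (inj₂ (e , d))
        ... | inj₂ e | inj₂ d = inj₁ (inj₂ (e , d))
        go : Mono (q 0) ⊎ X (q 0) ⊎ P (q 0) → Mono (q 1) ⊎ X (q 1) ⊎ P (q 1) → Mono (q 2) ⊎ X (q 2) ⊎ P (q 2) →
          Mono (q 3) ⊎ X (q 3) ⊎ P (q 3) → Mono (q 4) ⊎ X (q 4) ⊎ P (q 4) → Res ⊎ ∃[ q ] Inside f 6 q × Mono q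
        go (inj₁ m) _ _ _ _ = inj₂ (_ , i (s≤s z≤n) , m)
        go _ (inj₁ m) _ _ _ = inj₂ (_ , i (s≤s (s≤s z≤n)) , m)
        go _ _ (inj₁ m) _ _ = inj₂ (_ , i (s≤s (s≤s (s≤s z≤n))) , m)
        go _ _ _ (inj₁ m) _ = inj₂ (_ , i (s≤s (s≤s (s≤s (s≤s z≤n)))) , m)
        go _ _ _ _ (inj₁ m) = inj₂ (_ , i (s≤s (s≤s (s≤s (s≤s (s≤s z≤n))))) , m)
        go (inj₂ a) (inj₂ b) (inj₂ c) (inj₂ d) (inj₂ e) = inj₁ (mixed⁵ T h a b c d e)

    twoMono : ∀ {q q′} → x ≢ p → q ≢ q′ → In q → In q′ →
      (Edge r x q × Edge r p q) × (Edge r x q′ × Edge r p q′) ⊎ (Edge b x q × Edge b p q) × (Edge b x q′ × Edge b p q′) → Res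
    twoMono x≢p n i i′ (inj₁ ((e , d) , (e′ , d′))) = cyc e (flip d) d′ (flip e′) n x≢p (inj₁ i) (inj₂ refl) (inj₁ i′)
    twoMono x≢p n i i′ (inj₂ ((e , d) , (e′ , d′))) = cyc e (flip d) d′ (flip e′) n x≢p (inj₁ i) (inj₂ refl) (inj₁ i′)

    -- Among three vertices, each joined to `x` and `p` in a single colour, two have the same colour
    -- and form a 4-cycle with `x` and `p`.
    thriceMono : ∀ D → (∀ {f t} → Tri f x p t → Throughout In f D → Res ⊎ ∃[ q ] Inside f D q × Mono q) →
      ∀ {f t} (T : Tri f x p t) → Throughout In f (D + (D + D)) → Res
    thriceMono D mono {f} T h
      with mono T (λ i → h (inside-mono (m≤m+n D (D + D)) i))
         | mono (fan T D) (λ i → h (fan-inside T D (inside-mono (m≤m+n D D) i)))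
         | mono (fan (fan T D) D) (λ i → h (fan-inside T D (fan-inside (fan T D) D i)))
    ... | inj₁ res | _ | _ = res
    ... | _ | inj₁ res | _ = res
    ... | _ | _ | inj₁ res = res
    ... | inj₂ (q₁ , i₁ , m₁) | inj₂ (q₂ , i₂ , m₂) | inj₂ (q₃ , i₃ , m₃) = twoOfThree m₁ m₂ m₃
      where
        in₁ : In q₁
        in₁ = h (inside-mono (m≤m+n D (D + D)) i₁)
        in₂ : In q₂
        in₂ = h (fan-inside T D (inside-mono (m≤m+n D D) i₂))
        in₃ : In q₃
        in₃ = h (fan-inside T D (fan-inside (fan T D) D i₃))
        x≢p : x ≢ p
        x≢p = Adj⇒≢ (rim T)
        12≢ : q₁ ≢ q₂
        12≢ = inside-fan-≢ T i₁ i₂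
        13≢ : q₁ ≢ q₃
        13≢ = inside-fan-≢ T i₁ (fan-inside (fan T D) D i₃)
        23≢ : q₂ ≢ q₃
        23≢ = inside-fan-≢ (fan T D) i₂ i₃
        twoOfThree : Mono q₁ → Mono q₂ → Mono q₃ → Res
        twoOfThree (inj₁ a) (inj₁ b) _ = twoMono x≢p 12≢ in₁ in₂ (inj₁ (a , b))
        twoOfThree (inj₂ a) (inj₂ b) _ = twoMono x≢p 12≢ in₁ in₂ (inj₂ (a , b))
        twoOfThree (inj₁ a) _ (inj₁ b) = twoMono x≢p 13≢ in₁ in₃ (inj₁ (a , b))
        twoOfThree (inj₂ a) _ (inj₂ b) = twoMono x≢p 13≢ in₁ in₃ (inj₂ (a , b))
        twoOfThree _ (inj₁ a) (inj₁ b) = twoMono x≢p 23≢ in₂ in₃ (inj₁ (a , b))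
        twoOfThree _ (inj₂ a) (inj₂ b) = twoMono x≢p 23≢ in₂ in₃ (inj₂ (a , b))

    -- 18 is three times 6: each of three blocks needs five consecutive fan vertices and one further
    -- level for the vertex `m` beside the last.
    cycleInFan : ∀ {f t} → Tri f x p t → Throughout In f 18 → Res
    cycleInFan = thriceMono 6 mono⁵

-- Jellyfish

-- Levels used up by the constructions in `Jellies`. A sum `k * d + k * d` stands for the two
-- stretches of `collect₂`, a product `(k + k) * d` for a collection later split between two
-- colours.
module JellyDepths (k : ℕ) where
  leafDepth unitDepth linkDepth richDepth pairDepth pureDepth branchDepth : ℕ
  leafDepth   = k * 1 + k * 1
  unitDepth   = 4 + suc leafDepth
  linkDepth   = suc (k * unitDepth + k * unitDepth)
  richDepth   = (k + k) * 1
  pairDepth   = (k + k) * (linkDepth + suc richDepth)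
  pureDepth   = k * (linkDepth + suc (k * pairDepth))
  branchDepth = pureDepth + suc (k * pureDepth)

  petalDepth jellyDepth : ℕ → ℕ
  petalDepth d = suc ((k + k) * (d + branchDepth))
  jellyDepth d = (k + k) * (petalDepth d + branchDepth)

module Jellies (k N : ℕ) (c : Point → Point → Bool) (c-sym : ∀ u v → c u v ≡ c v u) where
  open Coloured c c-sym
  open JellyDepths k

  -- The colouring will come from Tr(N) and mean nothing above level `N`, so all vertices of a copy
  -- have to stay low.
  Low : Point → Set
  Low v = level v ≤ N

  -- `nothing` indexes a child of the root `x`, and `just l` the children of that child.
  IsBranch : Bool → Point → (Maybe (Fin k) → Point) → Set
  IsBranch b x e = Edge b x (e nothing) × (∀ l → Edge b (e nothing) (e (just l))) × (∀ {i j} → e i ≡ e j → i ≡ j)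

  Branch : Bool → Point → (Point → Set) → Set
  Branch b x In = Σ (Maybe (Fin k) → Point) λ e → IsBranch b x e × (∀ i → In (e i))

  -- One petal and one branch at a common root; `k` disjoint units of one colour form the jellyfish.
  Unit : Set
  Unit = Fin 3 ⊎ Maybe (Fin k)

  IsUnit : Bool → Point → (Unit → Point) → Set
  IsUnit b x e = IsPetal b x (λ i → e (inj₁ i)) × IsBranch b x (λ i → e (inj₂ i)) × (∀ i j → e (inj₁ i) ≢ e (inj₂ j))

  Leaves : Bool → Point → Addr → ℕ → Set
  Leaves b v = Placedⁿ ⊤ (λ e → Edge b v (e tt)) k

  mkBranch : ∀ {b x v f n In} → Edge b x v → Leaves b v f n → In v → Throughout In f n → Branch b x In
  mkBranch {v = v} {In = In} xv r iv h = e , (xv , holds r , λ {i} {j} → inj i j) , ins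
    where
      e : Maybe (Fin k) → Point
      e nothing  = v
      e (just l) = at r l tt
      inj : ∀ i j → e i ≡ e j → i ≡ j
      inj nothing  nothing  eq = refl
      inj nothing  (just l) eq = ⊥-elim (Edge⇒≢ (holds r l) eq)
      inj (just l) nothing  eq = ⊥-elim (Edge⇒≢ (holds r l) (sym eq))
      inj (just l) (just m) eq = cong just (disjoint r eq)
      ins : ∀ i → In (e i)
      ins nothing  = iv
      ins (just l) = h (inside r l tt)

  mkUnit : ∀ {b x y z w f A B} (T : Tri f y z w) →
    Petal b x (Inside f A) → Branch b x (Inside (fanAddr T A) B) → Placed Unit (IsUnit b x) f (A + B)
  mkUnit {f = f} {A} {B} T (e , pe , ie) (d , pd , id) =
    [ e , d ]′ , (pe , pd , λ i j → inside-fan-≢ T (ie i) (id j)) , ins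
    where
      ins : ∀ a → Inside f (A + B) ([ e , d ]′ a)
      ins (inj₁ i) = inside-mono (m≤m+n A B) (ie i)
      ins (inj₂ j) = fan-inside T A (id j)

  record MonoJelly : Set where
    field
      colour : Bool
      emb    : JV k → Point
      emb-≡  : ∀ i j → emb i ≡ emb j → i ≡ j
      emb-E  : ∀ {i j} → JE k i j → Edge colour (emb i) (emb j)
      low    : ∀ i → Low (emb i)

  mkJelly : ∀ {b x y z f n} → Tri f x y z → Low x → Throughout Low f n → Placedⁿ Unit (IsUnit b x) k f n → MonoJelly
  mkJelly {b} {x} T lx h r = record { colour = b ; emb = emb ; emb-≡ = emb-≡ ; emb-E = emb-E ; low = low }
    where
      emb : JV k → Point
      emb root         = x
      emb (petal i a)  = at r i (inj₁ a)
      emb (child i)    = at r i (inj₂ nothing)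
      emb (gchild i l) = at r i (inj₂ (just l))
      low : ∀ i → Low (emb i)
      low root         = lx
      low (petal i a)  = h (inside r i _)
      low (child i)    = h (inside r i _)
      low (gchild i l) = h (inside r i _)
      x≢ : ∀ {i a} → x ≢ at r i a
      x≢ = tri-≢-inside T (inside r _ _)
      unitInj : ∀ i {a a′} → at r i a ≡ at r i a′ → a ≡ a′
      unitInj i {inj₁ a} {inj₁ a′} eq = cong inj₁ (proj₂ (proj₂ (proj₂ (proj₂ (proj₁ (holds r i))))) eq)
      unitInj i {inj₁ a} {inj₂ a′} eq = ⊥-elim (proj₂ (proj₂ (holds r i)) _ _ eq)
      unitInj i {inj₂ a} {inj₁ a′} eq = ⊥-elim (proj₂ (proj₂ (holds r i)) _ _ (sym eq))
      unitInj i {inj₂ a} {inj₂ a′} eq = cong inj₂ (proj₂ (proj₂ (proj₁ (proj₂ (holds r i)))) eq)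
      place : Fin k × Unit → JV k
      place (i , inj₁ a)        = petal i a
      place (i , inj₂ nothing)  = child i
      place (i , inj₂ (just l)) = gchild i l
      inj : ∀ {i j a a′} → at r i a ≡ at r j a′ → place (i , a) ≡ place (j , a′)
      inj {i} eq with disjoint r eq
      ... | refl with unitInj i eq
      ... | refl = refl
      emb-≡ : ∀ i j → emb i ≡ emb j → i ≡ j
      emb-≡ root         root         eq = refl
      emb-≡ root         (petal _ _)  eq = ⊥-elim (x≢ eq)
      emb-≡ root         (child _)    eq = ⊥-elim (x≢ eq)
      emb-≡ root         (gchild _ _) eq = ⊥-elim (x≢ eq)
      emb-≡ (petal _ _)  root         eq = ⊥-elim (x≢ (sym eq))
      emb-≡ (child _)    root         eq = ⊥-elim (x≢ (sym eq))
      emb-≡ (gchild _ _) root         eq = ⊥-elim (x≢ (sym eq))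
      emb-≡ (petal _ _)  (petal _ _)  eq = inj eq
      emb-≡ (petal _ _)  (child _)    eq = inj eq
      emb-≡ (petal _ _)  (gchild _ _) eq = inj eq
      emb-≡ (child _)    (petal _ _)  eq = inj eq
      emb-≡ (child _)    (child _)    eq = inj eq
      emb-≡ (child _)    (gchild _ _) eq = inj eq
      emb-≡ (gchild _ _) (petal _ _)  eq = inj eq
      emb-≡ (gchild _ _) (child _)    eq = inj eq
      emb-≡ (gchild _ _) (gchild _ _) eq = inj eq
      emb-E : ∀ {i j} → JE k i j → Edge b (emb i) (emb j)
      emb-E (p0 i)   = let (e , _) , _ = holds r i in e
      emb-E (p1 i)   = let (_ , e , _) , _ = holds r i in e
      emb-E (p2 i)   = let (_ , _ , e , _) , _ = holds r i in e
      emb-E (p3 i)   = let (_ , _ , _ , e , _) , _ = holds r i in e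
      emb-E (t1 j)   = let _ , (e , _) , _ = holds r j in e
      emb-E (t2 j l) = let _ , (_ , e , _) , _ = holds r j in e l

  -- Vacuous unless v is a later neighbour of x.
  PureAt : Bool → Point → Point → Set
  PureAt b x (inj₁ _) = ⊤
  PureAt b x (inj₂ f) = ∀ i → vertexOf f i ≡ x → c x (inj₂ f) ≡ b

  pureSpoke : ∀ {b} → Tri f x y z → PureAt b x (inj₂ f) → Edge b x (inj₂ f)
  pureSpoke T h with tri-vertex T
  ... | i , eq = spoke T , h i eq

  -- Here `x` is pure of colour `b`. A vertex with two neighbours of colour `b` in the link of `x`
  -- closes a petal at `x`, as in `clash`; without such petals the link is mostly of colour `not b`
  -- and has room for a jellyfish of that colour.
  module Link {b : Bool} {x : Point} {In : Point → Set} where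
    R : Point → Set
    R v = In v × PureAt b x v × Low v

    Seen : Point → Point → Set
    Seen a v = Edge b x v × Edge b a v × In v

    clash : ∀ {a v w} → In a → Seen a v → Seen a w → v ≢ w → Petal b x In
    clash ia (xv , av , iv) (xw , aw , iw) ne = mkPetal xv (flip av) aw (flip xw) ne iv ia iw

    leaves : ∀ {w} → In w → ∀ {g z} → Tri g x w z → Throughout R g leafDepth → Petal b x In ⊎ Leaves (not b) w g leafDepth
    leaves {w} iw = collect₂ {B = Seen w} {D = 1} (clash iw) place k
      where
        place : ∀ {f z} → Tri f x w z → Throughout R f 1 →
          Petal b x In ⊎ (∃[ v ] Inside f 1 v × Seen w v) ⊎ Placed ⊤ (λ e → Edge (not b) w (e tt)) f 1
        place S h with edge? b (spoke (swapˡ S)) | h centre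
        ... | inj₁ e | iv , pv , _ = inj₂ (inj₁ (_ , centre , (pureSpoke S pv , e , iv)))
        ... | inj₂ e | _ = inj₂ (inj₂ ((λ _ → inj₂ _) , e , λ _ → centre))

    module _ {a} (ia : In a) where
      seen? : ∀ {g w n} → (T : Tri g x a w) → Throughout R g (suc n) → Seen a (new g) ⊎ Edge (not b) a (new g)
      seen? T h with edge? b (spoke (swapˡ T)) | h centre
      ... | inj₁ e | iv , pv , _ = inj₁ (pureSpoke T pv , e , iv)
      ... | inj₂ e | _ = inj₂ e

      -- w and w′ are consecutive in the fan over xa; the edges of colour b form a matching in the link of x.
      petalAbove : ∀ {g w} (T : Tri g x a w) → Throughout R g 2 → In w → Edge b x w →
        Edge (not b) a w → Edge (not b) a (new g) → Edge b w (new g) → ∀ {f n} → (∀ {v} → Inside g 2 v → Inside f n v) → Inside f n w →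
        Petal b x In ⊎ Petal (not b) a (Inside f n)
      petalAbove {g} {w} T h iw xw aw aw′ ww′ sub-in w-in = go (edge? b (spoke (swapˡ U))) (edge? b (spoke (third U)))
        where
          U : Tri (side (swapʳ T) ∷ g) x w (new g)
          U = sub (swapʳ T)
          m : Point
          m = new (side (swapʳ T) ∷ g)
          im : In m
          im = proj₁ (h (deeper _ centre))
          iw′ : In (new g)
          iw′ = proj₁ (h centre)
          xm : Edge b x m
          xm = pureSpoke U (proj₁ (proj₂ (h (deeper _ centre))))
          xw′ : Edge b x (new g)
          xw′ = pureSpoke T (proj₁ (proj₂ (h centre)))
          go : Edge b w m ⊎ Edge (not b) w m → Edge b (new g) m ⊎ Edge (not b) (new g) m → _
          go (inj₁ e) _ = inj₁ (mkPetal xm (flip e) ww′ (flip xw′) (λ eq → tri-≢-centre (third U) (sym eq)) im iw iw′)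
          go _ (inj₁ e) = inj₁ (mkPetal xw ww′ e (flip xm) (tri-≢-centre (swapˡ U)) iw iw′ im)
          go (inj₂ e) (inj₂ e′) =
            inj₂ (mkPetal aw e (flip e′) (flip aw′) (Edge⇒≢ ww′) w-in (sub-in (deeper _ centre)) (sub-in centre))

      -- The path `w₁ w₂ w₃` in the fan over `x a` closes to a petal at `a` if both its edges have
      -- colour `not b`; otherwise `petalAbove` makes a detour around an edge of colour `b`. The
      -- petal may reach depth 4, so the branch starts only at `w₅`.
      unit : ∀ {g w} → Tri g x a w → Throughout R g unitDepth →
        Petal b x In ⊎ (∃[ v ] Inside g unitDepth v × Seen a v) ⊎ Placed Unit (IsUnit (not b) a) g unitDepth
      unit {g} T₀ h₀ = go (seen? T₀ h₀) (seen? T₁ h₁) (seen? T₂ h₂) (seen? T₄ h₄)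
        where
          T₁ = sub T₀
          T₂ = sub T₁
          T₄ = fan T₀ 4
          h₁ : Throughout R (side T₀ ∷ g) (3 + suc leafDepth)
          h₁ i = h₀ (deeper _ i)
          h₂ : Throughout R (side T₁ ∷ side T₀ ∷ g) (2 + suc leafDepth)
          h₂ i = h₁ (deeper _ i)
          h₄ : Throughout R (fanAddr T₀ 4) (suc leafDepth)
          h₄ i = h₀ (fan-inside T₀ 4 i)
          w₁ w₂ w₃ w₅ : Point
          w₁ = new g
          w₂ = new (side T₀ ∷ g)
          w₃ = new (side T₁ ∷ side T₀ ∷ g)
          w₅ = new (fanAddr T₀ 4)
          2≤ : ∀ {f m} → Throughout R f (2 + m) → Throughout R f 2
          2≤ h i = h (inside-mono (s≤s (s≤s z≤n)) i)
          petalAtA : Edge (not b) a w₁ → Edge (not b) a w₂ → Edge (not b) a w₃ → Petal b x In ⊎ Petal (not b) a (Inside g 4)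
          petalAtA e₁ e₂ e₃ with edge? b (spoke (third T₁)) | edge? b (spoke (third T₂))
          ... | inj₁ e | _ =
            petalAbove T₁ (2≤ h₁) (proj₁ (h₀ centre)) (pureSpoke T₀ (proj₁ (proj₂ (h₀ centre)))) e₁ e₂ e
              (λ i → inside-mono (s≤s (s≤s (s≤s z≤n))) (deeper _ i)) centre
          ... | _ | inj₁ e =
            petalAbove T₂ (2≤ h₂) (proj₁ (h₁ centre)) (pureSpoke T₁ (proj₁ (proj₂ (h₁ centre)))) e₂ e₃ e
              (λ i → deeper _ (deeper _ i)) (deeper _ centre)
          ... | inj₂ e | inj₂ e′ =
            inj₂ (mkPetal {In = Inside g 4} e₁ e e′ (flip e₃) (level<⇒≢ (s≤s (s≤s (n≤1+n _))))
              centre (deeper _ centre) (deeper _ (deeper _ centre)))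
          branchAtA : Edge (not b) a w₅ → Petal b x In ⊎ Branch (not b) a (Inside (fanAddr T₀ 4) (suc leafDepth))
          branchAtA e₅ = ⊎-map (λ q → q) (λ r → mkBranch e₅ r centre (λ i → deeper _ i))
            (leaves (proj₁ (h₄ centre)) (swapʳ (sub T₄)) (λ i → h₄ (deeper _ i)))
          go : Seen a w₁ ⊎ Edge (not b) a w₁ → Seen a w₂ ⊎ Edge (not b) a w₂ → Seen a w₃ ⊎ Edge (not b) a w₃ →
            Seen a w₅ ⊎ Edge (not b) a w₅ →
            Petal b x In ⊎ (∃[ v ] Inside g unitDepth v × Seen a v) ⊎ Placed Unit (IsUnit (not b) a) g unitDepth
          go (inj₁ s) _ _ _ = inj₂ (inj₁ (_ , centre , s))
          go _ (inj₁ s) _ _ = inj₂ (inj₁ (_ , deeper _ centre , s))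
          go _ _ (inj₁ s) _ = inj₂ (inj₁ (_ , deeper _ (deeper _ centre) , s))
          go _ _ _ (inj₁ s) = inj₂ (inj₁ (_ , fan-inside T₀ 4 centre , s))
          go (inj₂ e₁) (inj₂ e₂) (inj₂ e₃) (inj₂ e₅) with petalAtA e₁ e₂ e₃ | branchAtA e₅
          ... | inj₁ q | _ = inj₁ q
          ... | _ | inj₁ q = inj₁ q
          ... | inj₂ p | inj₂ q = inj₂ (inj₂ (mkUnit T₀ p q))

    -- The jellyfish has colour `not b` and root `new f`; its units are collected along the fan over
    -- `x` and that root.
    petalOrJelly : ∀ {f u t} → Tri f x u t → Throughout R f linkDepth → Petal b x In ⊎ MonoJelly
    petalOrJelly {f} T h =
      ⊎-map (λ q → q) (mkJelly (swapˡ S) (proj₂ (proj₂ (h centre))) (λ i → proj₂ (proj₂ (h (deeper _ i)))))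
        (collect₂ (clash ia) (unit ia) k S (λ i → h (deeper _ i)))
      where
        S = swapʳ (sub T)
        ia = proj₁ (h centre)

  rich? : ∀ b {q x z f} → Tri f q x z → Leaves b q f richDepth ⊎ Leaves (not b) q f richDepth
  rich? b {q} {x} T = split k k
    ([ ⊥-elim , (λ r → r) ]′ (collect {Q = ⊥} {R = λ _ → ⊤} place (k + k) T (λ _ → tt)))
    where
      place : ∀ {f z} → Tri f q x z → Throughout (λ _ → ⊤) f 1 →
        ⊥ ⊎ Placed ⊤ (λ e → Edge b q (e tt) ⊎ Edge (not b) q (e tt)) f 1
      place S _ = inj₂ ((λ _ → inj₂ _) , edge? b (spoke S) , λ _ → centre)

  inside-pure : ∀ {b x f n} {R : Point → Set} → (∀ {v} → R v → PureAt b x v × Low v) → Throughout R f n →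
    Throughout (Link.R {b} {x} {Inside f n}) f n
  inside-pure g h i = i , g (h i)

  -- Each later common neighbour q of x and p is joined to x in colour b, to p in the other colour,
  -- and has many neighbours in one of the two colours.
  oppositePure⇒jelly : ∀ {b x p f t} → Tri f x p t → Low x → Low p →
    Throughout (λ v → PureAt b x v × PureAt (not b) p v × Low v) f pairDepth → MonoJelly
  oppositePure⇒jelly {b} {x} {p} T lx lp h =
    [ (λ J → J) , (λ r → [ mkJelly T lx low , mkJelly (swapˡ T) lp low ]′ (split k k r)) ]′
      (collect place (k + k) T h)
    where
      low : Throughout Low _ pairDepth
      low i = proj₂ (proj₂ (h i))
      R : Point → Set
      R v = PureAt b x v × PureAt (not b) p v × Low v
      place : ∀ {f t} → Tri f x p t → Throughout R f (linkDepth + suc richDepth) →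
        MonoJelly ⊎ Placed Unit (λ e → IsUnit b x e ⊎ IsUnit (not b) p e) f (linkDepth + suc richDepth)
      place {f} S hS
        with Link.petalOrJelly S (inside-pure (λ (px , _ , l) → px , l) h₁)
           | Link.petalOrJelly (swapˡ S) (inside-pure (λ (_ , pp , l) → pp , l) h₁)
           | rich? b {x = x} (swapˡ (swapʳ (sub (fan S linkDepth))))
        where
          h₁ : Throughout R f linkDepth
          h₁ i = hS (inside-mono (m≤m+n _ _) i)
      ... | inj₂ J | _ | _ = inj₁ J
      ... | _ | inj₂ J | _ = inj₁ J
      ... | inj₁ px | inj₁ pp | r = inj₂ ([ unitˣ , unitᵖ ]′ r)
        where
          F = fan S linkDepth
          hF = hS (fan-inside S linkDepth centre)
          unitˣ : _ → Placed Unit (λ e → IsUnit b x e ⊎ IsUnit (not b) p e) f (linkDepth + suc richDepth)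
          unitˣ l = let e , u , i = mkUnit S px (mkBranch (pureSpoke F (proj₁ hF)) l centre (λ i → deeper _ i))
                    in e , inj₁ u , i
          unitᵖ : _ → Placed Unit (λ e → IsUnit b x e ⊎ IsUnit (not b) p e) f (linkDepth + suc richDepth)
          unitᵖ l = let e , u , i = mkUnit S pp (mkBranch (pureSpoke (swapˡ F) (proj₁ (proj₂ hF))) l centre (λ i → deeper _ i))
                    in e , inj₂ u , i

  -- The case distinction on purity is constructive because only finitely many vertices have to be
  -- inspected.
  search : ∀ b p f n → Throughout (PureAt b p) f n ⊎ ∃[ v ] Inside f n v × Edge (not b) p v
  search b p f zero = inj₁ λ ()
  search b p f (suc n) with first
    where
      first : PureAt b p (new f) ⊎ Edge (not b) p (new f)
      first with colour? b (c p (new f)) | Fin.any? (λ i → vertexOf f i ≟ᴾ p)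
      ... | inj₁ e | _ = inj₁ λ _ _ → e
      ... | inj₂ e | yes (i , refl) = inj₂ (up f i , e)
      ... | inj₂ e | no none = inj₁ λ i eq → ⊥-elim (none (i , eq))
  ... | inj₂ e = inj₂ (_ , centre , e)
  ... | inj₁ h with search b p (0F ∷ f) n | search b p (1F ∷ f) n | search b p (2F ∷ f) n
  ... | inj₂ (v , i , e) | _ | _ = inj₂ (v , deeper _ i , e)
  ... | _ | inj₂ (v , i , e) | _ = inj₂ (v , deeper _ i , e)
  ... | _ | _ | inj₂ (v , i , e) = inj₂ (v , deeper _ i , e)
  ... | inj₁ h₀ | inj₁ h₁ | inj₁ h₂ = inj₁ λ where
    centre          → h
    (deeper 0F i) → h₀ i
    (deeper 1F i) → h₁ i
    (deeper 2F i) → h₂ i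

  -- `petalOrJelly` supplies the petals. For a branch, purity joins `x` to a fan vertex `p` in
  -- colour `b`, and leaves of `p` are sought in faces over `p x`. A face with no such leaf makes
  -- `p` pure of colour `not b` there, beside `x` of colour `b`.
  pure⇒jelly : ∀ {b x f t u} → Tri f x u t → Low x →
    Throughout (λ v → PureAt b x v × Low v) f pureDepth → MonoJelly
  pure⇒jelly {b} {x} {u = u} T lx h = [ (λ J → J) , mkJelly T lx (λ i → proj₂ (h i)) ]′ (collect place k T h)
    where
      R : Point → Set
      R v = PureAt b x v × Low v
      place : ∀ {f t} → Tri f x u t → Throughout R f (linkDepth + suc (k * pairDepth)) →
        MonoJelly ⊎ Placed Unit (IsUnit b x) f (linkDepth + suc (k * pairDepth))
      place {f} S hS with Link.petalOrJelly S (inside-pure (λ r → r) (λ i → hS (inside-mono (m≤m+n _ _) i)))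
                        | collect leaf k (swapˡ (swapʳ (sub F))) (λ i → hF (deeper _ i))
        where
          F = fan S linkDepth
          p : Point
          p = new (fanAddr S linkDepth)
          hF : Throughout R (fanAddr S linkDepth) (suc (k * pairDepth))
          hF i = hS (fan-inside S linkDepth i)
          leaf : ∀ {g z} → Tri g p x z → Throughout R g pairDepth → MonoJelly ⊎ Placed ⊤ (λ e → Edge b p (e tt)) g pairDepth
          leaf {g} G hG with search (not b) p g pairDepth
          ... | inj₁ pp = inj₁ (oppositePure⇒jelly (swapˡ G) lx (proj₂ (hF centre)) λ i → proj₁ (hG i) , pp i , proj₂ (hG i))
          ... | inj₂ (v , i , e) = inj₂ ((λ _ → v) , subst (λ d → Edge d p v) (not-involutive b) e , λ _ → i)
      ... | inj₂ J | _ = inj₁ J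
      ... | _ | inj₁ J = inj₁ J
      ... | inj₁ px | inj₂ l =
        inj₂ (mkUnit S px (mkBranch (pureSpoke (fan S linkDepth) (proj₁ (hS (fan-inside S linkDepth centre)))) l centre (λ i → deeper _ i)))

  neighbour : ∀ b {x f t u} → Tri f x u t → Low x → Throughout Low f pureDepth →
    MonoJelly ⊎ ∃[ v ] Inside f pureDepth v × Edge b x v
  neighbour b {x} {f} T lx h with search (not b) x f pureDepth
  ... | inj₁ px = inj₁ (pure⇒jelly T lx λ i → px i , h i)
  ... | inj₂ (v , i , e) = inj₂ (v , i , subst (λ d → Edge d x v) (not-involutive b) e)

  below : ∀ {f n v} → Inside f n v → ∃[ g ] v ≡ new g × (∀ {m w} → Inside g m w → Inside f (n + m) w)
  below {n = suc n} centre = _ , refl , λ i → inside-mono (m≤n+m _ (suc n)) i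
  below (deeper j i) with below i
  ... | g , eq , h = g , eq , λ i → deeper j (h i)

  -- `neighbour` is used once at `x`, and then `k` times at the vertex `v` that it finds.
  branch : ∀ b {x f t u} → Tri f x u t → Low x → Throughout Low f branchDepth →
    MonoJelly ⊎ Branch b x (Inside f branchDepth)
  branch b {f = f} T lx h with neighbour b T lx (λ i → h (inside-mono (m≤m+n _ _) i))
  ... | inj₁ J = inj₁ J
  ... | inj₂ (v , i , e) with below i
  ... | g , refl , h′ = ⊎-map (λ J → J)
    (λ l → mkBranch e l (inside-mono (m≤m+n _ _) i) (λ j → h′ (deeper 0F j)))
    -- `v` is the last corner of each subface of `g`; the choice of `0F` is arbitrary.
    (collect leaf k t201 (λ j → h (h′ (deeper 0F j))))
    where
      lv : Low v
      lv = h (inside-mono (m≤m+n _ _) i)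
      leaf : ∀ {f u z} → Tri f v u z → Throughout Low f pureDepth → MonoJelly ⊎ Placed ⊤ (λ e → Edge b v (e tt)) f pureDepth
      leaf S hS = ⊎-map (λ J → J) (λ (w , i , e) → (λ _ → w) , e , λ _ → i) (neighbour b S lv hS)

  byColour : {A : Bool → Set} → ∃[ b ] A b → A true ⊎ A false
  byColour (true  , a) = inj₁ a
  byColour (false , a) = inj₂ a

  -- A cycle found at `p` that passes through `x` is rotated to start at `x`. Hence a petal at `x`
  -- may contain `p`, while a petal at `p` avoids `x` and can be repeated along the fan.
  cycle⇒petal : ∀ {x p} {In : Point → Set} → Cycle x p In ⊎ Cycle p x In →
    (∃[ b ] Petal b x (λ v → In v ⊎ v ≡ p)) ⊎ (∃[ b ] Petal b p In)
  cycle⇒petal (inj₁ (b , cycle e₁ e₂ e₃ e₄ ne _ i₁ i₂ i₃)) = inj₁ (b , mkPetal e₁ e₂ e₃ e₄ ne i₁ i₂ i₃)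
  cycle⇒petal {x} {p} {In} (inj₂ (b , cycle e₁ e₂ e₃ e₄ ne p≢ (inj₁ i₁) (inj₁ i₂) (inj₁ i₃))) = inj₂ (b , mkPetal e₁ e₂ e₃ e₄ ne i₁ i₂ i₃)
  cycle⇒petal {x} {p} {In} (inj₂ (b , cycle e₁ e₂ e₃ e₄ ne p≢ (inj₂ refl) (inj₁ i₂) (inj₁ i₃))) =
    inj₁ (b , mkPetal {In = λ v → In v ⊎ v ≡ p} e₂ e₃ e₄ e₁ (λ eq → p≢ (sym eq)) (inj₁ i₂) (inj₁ i₃) (inj₂ refl))
  cycle⇒petal {x} {p} {In} (inj₂ (b , cycle e₁ e₂ e₃ e₄ ne p≢ (inj₁ i₁) (inj₂ refl) (inj₁ i₃))) =
    inj₁ (b , mkPetal {In = λ v → In v ⊎ v ≡ p} e₃ e₄ e₁ e₂ (λ eq → ne (sym eq)) (inj₁ i₃) (inj₂ refl) (inj₁ i₁))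
  cycle⇒petal {x} {p} {In} (inj₂ (b , cycle e₁ e₂ e₃ e₄ ne p≢ (inj₁ i₁) (inj₁ i₂) (inj₂ refl))) =
    inj₁ (b , mkPetal {In = λ v → In v ⊎ v ≡ p} e₄ e₁ e₂ e₃ p≢ (inj₂ refl) (inj₁ i₁) (inj₁ i₂))
  cycle⇒petal {x} {p} {In} (inj₂ (b , cycle e₁ e₂ e₃ e₄ ne p≢ (inj₂ refl) (inj₂ refl) _)) = ⊥-elim (Edge⇒≢ e₂ refl)
  cycle⇒petal {x} {p} {In} (inj₂ (b , cycle e₁ e₂ e₃ e₄ ne p≢ _ (inj₂ refl) (inj₂ refl))) = ⊥-elim (Edge⇒≢ e₃ refl)
  cycle⇒petal {x} {p} {In} (inj₂ (b , cycle e₁ e₂ e₃ e₄ ne p≢ (inj₂ refl) _ (inj₂ refl))) = ⊥-elim (ne refl)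

  fanPetal : ∀ {x p f t} {In : Point → Set} → Tri f x p t → Throughout In f 18 →
    (∃[ b ] Petal b x (λ v → In v ⊎ v ≡ p)) ⊎ (∃[ b ] Petal b p In)
  fanPetal {x} {p} T h = cycle⇒petal (Fan.cycleInFan (λ d → colour? (c x p) d) (rim T , refl) T h)

  module _ (cycleDepth : ℕ)
    (fanPetal : ∀ {x p f t} {In : Point → Set} → Tri f x p t → Throughout In f cycleDepth →
      (∃[ b ] Petal b x (λ v → In v ⊎ v ≡ p)) ⊎ (∃[ b ] Petal b p In)) where

    private
      dₚ : ℕ
      dₚ = petalDepth cycleDepth

    -- In the fan over `x` and `p = new f`, a petal at `x` may use `p`, which lies inside `f`. If
    -- none occurs, every block has a petal at `p`, completed by a branch of its colour; of `k + k`
    -- such units `k` agree in colour and form a jellyfish at `p`.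
    anyPetal : ∀ {x u f t} → Tri f x u t → Low x → Throughout Low f dₚ →
      MonoJelly ⊎ (∃[ b ] Petal b x (Inside f dₚ))
    anyPetal {x} {u} {f} T lx h = finish (collect place (k + k) S (λ i → h (deeper _ i) , deeper _ i))
      where
        p : Point
        p = new f
        S : Tri (side T ∷ f) x p u
        S = swapʳ (sub T)
        R : Point → Set
        R v = Low v × Inside f dₚ v
        Q : Set
        Q = MonoJelly ⊎ (∃[ b ] Petal b x (Inside f dₚ))
        place : ∀ {g t} → Tri g x p t → Throughout R g (cycleDepth + branchDepth) →
          Q ⊎ Placed Unit (λ e → IsUnit true p e ⊎ IsUnit false p e) g (cycleDepth + branchDepth)
        place {g} G hG with fanPetal {In = Inside g cycleDepth} G (λ i → i)
        ... | inj₁ (b , e , pe , i) = inj₁ (inj₂ (b , e , pe ,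
                λ a → [ (λ j → proj₂ (hG (inside-mono (m≤m+n _ _) j))) , (λ { eq → subst (Inside f dₚ) (sym eq) centre }) ]′ (i a)))
        ... | inj₂ (b , pt) with branch b (swapˡ (fan G cycleDepth)) (h centre) (λ i → proj₁ (hG (fan-inside G cycleDepth i)))
        ... | inj₁ J = inj₁ (inj₁ J)
        ... | inj₂ br = let e , u , i = mkUnit G pt br in inj₂ (e , byColour {λ b → IsUnit b p e} (b , u) , i)
        finish : _ → Q
        finish (inj₁ q) = q
        finish (inj₂ r) = inj₁ ([ mkJelly (swapˡ S) (h centre) low , mkJelly (swapˡ S) (h centre) low ]′ (split k k r))
          where
            low : Throughout Low (side T ∷ f) ((k + k) * (cycleDepth + branchDepth))
            low i = h (deeper _ i)

    -- The colour of each petal is not under control, but `branch` provides either colour, so a unit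
    -- can be completed in the colour of its petal.
    jelly : ∀ {x u f t} → Tri f x u t → Low x → Throughout Low f (jellyDepth cycleDepth) → MonoJelly
    jelly {x} {u} T lx h = [ (λ J → J) , (λ r → [ mkJelly T lx h , mkJelly T lx h ]′ (split k k r)) ]′ (collect place (k + k) T h)
      where
        place : ∀ {g t} → Tri g x u t → Throughout Low g (dₚ + branchDepth) →
          MonoJelly ⊎ Placed Unit (λ e → IsUnit true x e ⊎ IsUnit false x e) g (dₚ + branchDepth)
        place G hG with anyPetal G lx (λ i → hG (inside-mono (m≤m+n _ _) i))
        ... | inj₁ J = inj₁ J
        ... | inj₂ (b , pt) with branch b (fan G dₚ) lx (λ i → hG (fan-inside G dₚ i))
        ... | inj₁ J = inj₁ J
        ... | inj₂ br = let e , u , i = mkUnit G pt br in inj₂ (e , byColour {λ b → IsUnit b x e} (b , u) , i)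

-- Bistars

↑-disjoint : ∀ {m n} (i : Fin m) (j : Fin n) → i ↑ˡ n ≢ m ↑ʳ j
↑-disjoint {m} {n} i j eq with trans (sym (Fin.splitAt-↑ˡ m i n)) (trans (cong (splitAt m) eq) (Fin.splitAt-↑ʳ m n j))
... | ()

edgeFace : Adj u v → ∃[ f ] ∃[ z ] Tri f u v z × (∀ {L} → level u ≤ L → level v ≤ L → length f ≤ L)
edgeFace (base {0F} {0F} p) = ⊥-elim (p refl)
edgeFace (base {0F} {1F} p) = [] , _ , t012 , λ _ _ → z≤n
edgeFace (base {0F} {2F} p) = [] , _ , t021 , λ _ _ → z≤n
edgeFace (base {1F} {0F} p) = [] , _ , t102 , λ _ _ → z≤n
edgeFace (base {1F} {1F} p) = ⊥-elim (p refl)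
edgeFace (base {1F} {2F} p) = [] , _ , t120 , λ _ _ → z≤n
edgeFace (base {2F} {0F} p) = [] , _ , t201 , λ _ _ → z≤n
edgeFace (base {2F} {1F} p) = [] , _ , t210 , λ _ _ → z≤n
edgeFace (base {2F} {2F} p) = ⊥-elim (p refl)
edgeFace (down f 0F) = 0F ∷ f , _ , t201 , λ l _ → l
edgeFace (down f 1F) = 0F ∷ f , _ , t210 , λ l _ → l
edgeFace (down f 2F) = 1F ∷ f , _ , t210 , λ l _ → l
edgeFace (up f 0F)   = 0F ∷ f , _ , t021 , λ _ l → l
edgeFace (up f 1F)   = 0F ∷ f , _ , t120 , λ _ l → l
edgeFace (up f 2F)   = 1F ∷ f , _ , t120 , λ _ l → l

deepFace : ∀ {L m} → Adj u v → level u ≤ L → level v ≤ L → L ≤ m →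
  ∃[ f ] ∃[ z ] Tri f u v z × length f ≡ m
deepFace {m = m} e lu lv Lm with edgeFace e
... | f , z , T , l = fanAddr T (m ∸ length f) , _ , fan T (m ∸ length f) ,
  trans (length-fan T (m ∸ length f)) (m∸n+n≡m (≤-trans (l lu lv) Lm))

-- Two common neighbours complete the 4-cycle and `k` more serve as leaves at each centre. A
-- `window` suffices for the three-way pigeonhole of `trichotomy`; `cycle⇒bistar` stacks three
-- windows beyond the 18 levels that contain a cycle.
module BistarDepths (k : ℕ) where
  common window bistarDepth : ℕ
  common      = 2 + (k + k)
  window      = (k + (k + common)) * 1
  bistarDepth = window + (window + (window + 18))

module Bistars (k : ℕ) (c : Point → Point → Bool) (c-sym : ∀ u v → c u v ≡ c v u) where
  open Coloured c c-sym
  open BistarDepths k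

  record MonoBistar (N : ℕ) : Set where
    field
      colour : Bool
      emb    : BV k → Point
      emb-≡  : ∀ i j → emb i ≡ emb j → i ≡ j
      emb-E  : ∀ {i j} → BE k i j → Edge colour (emb i) (emb j)
      low    : ∀ i → level (emb i) ≤ N

  Neighbours : Bool → Point → Addr → ℕ → Set
  Neighbours b u = Placedⁿ ⊤ (λ e → Edge b u (e tt)) k

  Common : Bool → Point → Point → Addr → ℕ → Set
  Common b u v = Placedⁿ ⊤ (λ e → Edge b u (e tt) × Edge b v (e tt)) common

  trichotomy : ∀ b {u v z f} → Tri f u v z →
    Neighbours b u f window ⊎ Neighbours b v f window ⊎ Common (not b) u v f window
  trichotomy b {u} {v} T =
    ⊎-map (λ r → r) (split k common)
      (split k (k + common) ([ ⊥-elim , (λ r → r) ]′ (collect {Q = ⊥} {R = λ _ → ⊤} place (k + (k + common)) T (λ _ → tt))))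
    where
      place : ∀ {f z} → Tri f u v z → Throughout (λ _ → ⊤) f 1 → ⊥ ⊎ Placed ⊤
        (λ e → Edge b u (e tt) ⊎ Edge b v (e tt) ⊎ Edge (not b) u (e tt) × Edge (not b) v (e tt)) f 1
      place S _ = inj₂ ((λ _ → inj₂ _) , type , λ _ → centre)
        where
          type : _
          type with edge? b (spoke S) | edge? b (spoke (swapˡ S))
          ... | inj₁ e | _ = inj₁ e
          ... | _ | inj₁ e = inj₂ (inj₁ e)
          ... | inj₂ e | inj₂ d = inj₂ (inj₂ (e , d))

  mkBistar : ∀ {N b} (s : Fin 4 → Point) (A B : Fin k → Point) →
    Edge b (s 0F) (s 1F) → Edge b (s 1F) (s 2F) → Edge b (s 2F) (s 3F) → Edge b (s 3F) (s 0F) →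
    s 0F ≢ s 2F → s 1F ≢ s 3F → (∀ j → Edge b (s 0F) (A j)) → (∀ j → Edge b (s 2F) (B j)) →
    (∀ {i j} → A i ≡ A j → i ≡ j) → (∀ {i j} → B i ≡ B j → i ≡ j) → (∀ i j → A i ≢ B j) →
    (∀ i j → s i ≢ A j) → (∀ i j → s i ≢ B j) →
    (∀ i → level (s i) ≤ N) → (∀ i → level (A i) ≤ N) → (∀ i → level (B i) ≤ N) → MonoBistar N
  mkBistar {N} {b} s A B e₀₁ e₁₂ e₂₃ e₃₀ n₀₂ n₁₃ eA eB injA injB nAB nA nB ls lA lB =
    record { colour = b ; emb = emb ; emb-≡ = emb-≡ ; emb-E = emb-E ; low = low }
    where
      emb : BV k → Point
      emb (c4 i)    = s i
      emb (leafA j) = A j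
      emb (leafB j) = B j
      s-≡ : ∀ i j → s i ≡ s j → i ≡ j
      s-≡ 0F 0F _ = refl
      s-≡ 0F 1F eq = ⊥-elim (Edge⇒≢ e₀₁ eq)
      s-≡ 0F 2F eq = ⊥-elim (n₀₂ eq)
      s-≡ 0F 3F eq = ⊥-elim (Edge⇒≢ e₃₀ (sym eq))
      s-≡ 1F 0F eq = ⊥-elim (Edge⇒≢ e₀₁ (sym eq))
      s-≡ 1F 1F _ = refl
      s-≡ 1F 2F eq = ⊥-elim (Edge⇒≢ e₁₂ eq)
      s-≡ 1F 3F eq = ⊥-elim (n₁₃ eq)
      s-≡ 2F 0F eq = ⊥-elim (n₀₂ (sym eq))
      s-≡ 2F 1F eq = ⊥-elim (Edge⇒≢ e₁₂ (sym eq))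
      s-≡ 2F 2F _ = refl
      s-≡ 2F 3F eq = ⊥-elim (Edge⇒≢ e₂₃ eq)
      s-≡ 3F 0F eq = ⊥-elim (Edge⇒≢ e₃₀ eq)
      s-≡ 3F 1F eq = ⊥-elim (n₁₃ (sym eq))
      s-≡ 3F 2F eq = ⊥-elim (Edge⇒≢ e₂₃ (sym eq))
      s-≡ 3F 3F _ = refl
      emb-≡ : ∀ i j → emb i ≡ emb j → i ≡ j
      emb-≡ (c4 i)    (c4 j)    eq = cong c4 (s-≡ i j eq)
      emb-≡ (c4 i)    (leafA j) eq = ⊥-elim (nA i j eq)
      emb-≡ (c4 i)    (leafB j) eq = ⊥-elim (nB i j eq)
      emb-≡ (leafA i) (c4 j)    eq = ⊥-elim (nA j i (sym eq))
      emb-≡ (leafA i) (leafA j) eq = cong leafA (injA eq)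
      emb-≡ (leafA i) (leafB j) eq = ⊥-elim (nAB i j eq)
      emb-≡ (leafB i) (c4 j)    eq = ⊥-elim (nB j i (sym eq))
      emb-≡ (leafB i) (leafA j) eq = ⊥-elim (nAB j i (sym eq))
      emb-≡ (leafB i) (leafB j) eq = cong leafB (injB eq)
      emb-E : ∀ {i j} → BE k i j → Edge b (emb i) (emb j)
      emb-E e01    = e₀₁
      emb-E e12    = e₁₂
      emb-E e23    = e₂₃
      emb-E e30    = e₃₀
      emb-E (sA i) = eA i
      emb-E (sB i) = eB i
      low : ∀ i → level (emb i) ≤ N
      low (c4 i)    = ls i
      low (leafA i) = lA i
      low (leafB i) = lB i

  quad : Point → Point → Point → Point → Fin 4 → Point
  quad v₀ v₁ v₂ v₃ 0F = v₀
  quad v₀ v₁ v₂ v₃ 1F = v₁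
  quad v₀ v₁ v₂ v₃ 2F = v₂
  quad v₀ v₁ v₂ v₃ 3F = v₃

  all⁴ : ∀ {P : Fin 4 → Set} → P 0F → P 1F → P 2F → P 3F → ∀ i → P i
  all⁴ a b c d 0F = a
  all⁴ a b c d 1F = b
  all⁴ a b c d 2F = c
  all⁴ a b c d 3F = d

  common⇒bistar : ∀ {b u v z f n N} → Tri f u v z → n + length f ≤ N → Common b u v f n → MonoBistar N
  common⇒bistar {u = u} {v} {f = f} {N = N} T le r =
    mkBistar (quad u (leaf 0F) v (leaf 1F)) A B
      (proj₁ (e 0F)) (flip (proj₂ (e 0F))) (proj₂ (e 1F)) (flip (proj₁ (e 1F)))
      (Adj⇒≢ (rim T)) (λ eq → 0≢1 (disjoint r eq)) (λ j → proj₁ (e _)) (λ j → proj₂ (e _))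
      (λ eq → Fin.↑ˡ-injective k _ _ (twice (disjoint r eq)))
      (λ eq → Fin.↑ʳ-injective k _ _ (twice (disjoint r eq)))
      (λ i j eq → ↑-disjoint i j (twice (disjoint r eq)))
      (λ i j → all⁴ {λ i → quad u (leaf 0F) v (leaf 1F) i ≢ A j} (u≢ _) (λ eq → 0≢ (disjoint r eq)) (v≢ _) (λ eq → 1≢ (disjoint r eq)) i)
      (λ i j → all⁴ {λ i → quad u (leaf 0F) v (leaf 1F) i ≢ B j} (u≢ _) (λ eq → 0≢ (disjoint r eq)) (v≢ _) (λ eq → 1≢ (disjoint r eq)) i)
      (all⁴ (lc T) (lw 0F) (lc (swapˡ T)) (lw 1F)) (λ i → lw _) (λ i → lw _)
    where
      leaf : Fin common → Point
      leaf i = at r i tt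
      A B : Fin k → Point
      A j = leaf (2 ↑ʳ (j ↑ˡ k))
      B j = leaf (2 ↑ʳ (k ↑ʳ j))
      e = holds r
      lw : ∀ i → level (leaf i) ≤ N
      lw i = ≤-trans (inside-level≤ (inside r i tt)) le
      lc : ∀ {x y z} → Tri f x y z → level x ≤ N
      lc T = ≤-trans (tri-level T) (≤-trans (m≤n+m _ _) le)
      0≢1 : _≢_ {A = Fin common} 0F 1F
      0≢1 ()
      0≢ : ∀ {i : Fin (k + k)} → 0F ≢ 2 ↑ʳ i
      0≢ ()
      1≢ : ∀ {i : Fin (k + k)} → 1F ≢ 2 ↑ʳ i
      1≢ ()
      u≢ : ∀ i → u ≢ leaf i
      u≢ i = tri-≢-inside T (inside r i tt)
      v≢ : ∀ i → v ≢ leaf i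
      v≢ i = tri-≢-inside (swapˡ T) (inside r i tt)
      twice : ∀ {i j : Fin (k + k)} → 2 ↑ʳ i ≡ 2 ↑ʳ j → i ≡ j
      twice eq = Fin.↑ʳ-injective 2 _ _ eq

  Rich : Bool → ℕ → Point → Set
  Rich b m u = ∃[ f ] length f ≡ m × Neighbours b u f window

  rich? : ∀ {b u v L} m {N} → Edge b u v → level u ≤ L → level v ≤ L → L ≤ m → window + m ≤ N →
    Rich b m u ⊎ Rich b m v ⊎ MonoBistar N
  rich? {b} m (e , _) lu lv Lm le with deepFace e lu lv Lm
  ... | f , z , T , eq = ⊎-map (λ r → f , eq , r)
    (⊎-map (λ r → f , eq , r) (common⇒bistar T (subst (λ l → window + l ≤ _) (sym eq) le))) (trichotomy b T)

  -- The cycle lies up to level `m`, the leaves of `v₀` between `m` and `m′`, and those of `v₂`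
  -- beyond `m′`, which makes all of them distinct.
  richOpposite : ∀ {b L m m′ N v₀ v₁ v₂ v₃} →
    Edge b v₀ v₁ → Edge b v₁ v₂ → Edge b v₂ v₃ → Edge b v₃ v₀ → v₀ ≢ v₂ → v₁ ≢ v₃ →
    (∀ i → level (quad v₀ v₁ v₂ v₃ i) ≤ L) → L ≤ m → window + m ≤ m′ → window + m′ ≤ N →
    Rich b m v₀ → Rich b m′ v₂ → MonoBistar N
  richOpposite {L = L} {m} {m′} {N} {v₀} {v₁} {v₂} {v₃} e₀ e₁ e₂ e₃ n₀ n₁ ls Lm mm′ le (f , refl , r) (g , refl , r′) =
    mkBistar (quad v₀ v₁ v₂ v₃) (λ j → at r j tt) (λ j → at r′ j tt) e₀ e₁ e₂ e₃ n₀ n₁ (holds r) (holds r′)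
      (disjoint r) (disjoint r′) (λ i j → level<⇒≢ (≤-<-trans (upper i) (inside-level> (inside r′ j tt))))
      (λ i j → level<⇒≢ (≤-<-trans (≤-trans (ls i) Lm) (inside-level> (inside r j tt))))
      (λ i j → level<⇒≢ (≤-<-trans (≤-trans (ls i) (≤-trans Lm m≤m′)) (inside-level> (inside r′ j tt))))
      (λ i → ≤-trans (ls i) (≤-trans Lm (≤-trans m≤m′ m′≤N)))
      (λ i → ≤-trans (upper i) m′≤N)
      (λ j → ≤-trans (inside-level≤ (inside r′ j tt)) le)
    where
      upper : ∀ i → level (at r i tt) ≤ length g
      upper i = ≤-trans (inside-level≤ (inside r i tt)) mm′
      m≤m′ : length f ≤ length g
      m≤m′ = ≤-trans (m≤n+m _ window) mm′
      m′≤N : length g ≤ N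
      m′≤N = ≤-trans (m≤n+m _ window) le

  -- Every edge of the cycle has a rich end or gives a bistar in the other colour. If the rich ends
  -- of `v₀ v₁` and `v₂ v₃` are not opposite, they are adjacent, and a rich end of the edge between
  -- the other two vertices is opposite to one of them. At most one of the last two edges enters a
  -- bistar, so both can be tested at depth `L₂`.
  cycle⇒bistar : ∀ {b L v₀ v₁ v₂ v₃} →
    Edge b v₀ v₁ → Edge b v₁ v₂ → Edge b v₂ v₃ → Edge b v₃ v₀ → v₀ ≢ v₂ → v₁ ≢ v₃ →
    level v₀ ≤ L → level v₁ ≤ L → level v₂ ≤ L → level v₃ ≤ L → MonoBistar (window + (window + (window + L)))
  cycle⇒bistar {b} {L} {v₀} {v₁} {v₂} {v₃} e₀ e₁ e₂ e₃ n₀ n₁ l₀ l₁ l₂ l₃ =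
    go (rich? L e₀ l₀ l₁ ≤-refl L₁≤N) (rich? L₁ e₂ l₂ l₃ L≤L₁ L₂≤N)
      (rich? L₂ e₁ l₁ l₂ L≤L₂ ≤-refl) (rich? L₂ e₃ l₃ l₀ L≤L₂ ≤-refl)
    where
      L₁ L₂ N : ℕ
      L₁ = window + L
      L₂ = window + L₁
      N  = window + L₂
      L≤L₁ : L ≤ L₁
      L≤L₁ = m≤n+m _ window
      L₁≤L₂ : L₁ ≤ L₂
      L₁≤L₂ = m≤n+m _ window
      L≤L₂ : L ≤ L₂
      L≤L₂ = ≤-trans L≤L₁ L₁≤L₂
      L₂≤N : L₂ ≤ N
      L₂≤N = m≤n+m _ window
      L₁≤N : L₁ ≤ N
      L₁≤N = ≤-trans L₁≤L₂ L₂≤N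
      go : Rich b L v₀ ⊎ Rich b L v₁ ⊎ MonoBistar N → Rich b L₁ v₂ ⊎ Rich b L₁ v₃ ⊎ MonoBistar N →
        Rich b L₂ v₁ ⊎ Rich b L₂ v₂ ⊎ MonoBistar N → Rich b L₂ v₃ ⊎ Rich b L₂ v₀ ⊎ MonoBistar N → MonoBistar N
      go (inj₂ (inj₂ B)) _ _ _ = B
      go _ (inj₂ (inj₂ B)) _ _ = B
      go _ _ (inj₂ (inj₂ B)) _ = B
      go _ _ _ (inj₂ (inj₂ B)) = B
      go (inj₁ r₀) (inj₁ r₂) _ _ =
        richOpposite e₀ e₁ e₂ e₃ n₀ n₁ (all⁴ l₀ l₁ l₂ l₃) ≤-refl ≤-refl L₂≤N r₀ r₂
      go (inj₂ (inj₁ r₁)) (inj₂ (inj₁ r₃)) _ _ =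
        richOpposite e₁ e₂ e₃ e₀ n₁ (λ eq → n₀ (sym eq)) (all⁴ l₁ l₂ l₃ l₀) ≤-refl ≤-refl L₂≤N r₁ r₃
      go _ (inj₂ (inj₁ r₃)) (inj₁ r₁) _ =
        richOpposite e₃ e₀ e₁ e₂ (λ eq → n₁ (sym eq)) n₀ (all⁴ l₃ l₀ l₁ l₂) L≤L₁ ≤-refl ≤-refl r₃ r₁
      go (inj₁ r₀) _ (inj₂ (inj₁ r₂)) _ =
        richOpposite e₀ e₁ e₂ e₃ n₀ n₁ (all⁴ l₀ l₁ l₂ l₃) ≤-refl L₁≤L₂ ≤-refl r₀ r₂
      go _ (inj₁ r₂) _ (inj₂ (inj₁ r₀)) =
        richOpposite e₂ e₃ e₀ e₁ (λ eq → n₀ (sym eq)) (λ eq → n₁ (sym eq)) (all⁴ l₂ l₃ l₀ l₁) L≤L₁ ≤-refl ≤-refl r₂ r₀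
      go (inj₂ (inj₁ r₁)) _ _ (inj₁ r₃) =
        richOpposite e₁ e₂ e₃ e₀ n₁ (λ eq → n₀ (sym eq)) (all⁴ l₁ l₂ l₃ l₀) ≤-refl L₁≤L₂ ≤-refl r₁ r₃

  bistar : MonoBistar bistarDepth
  bistar = finish (Fan.cycleInFan {In = λ v → level v ≤ 18} (λ d → colour? (c o p) d) (rim T , refl) T inside-level≤)
    where
      o p : Point
      o = inj₁ 0F
      p = inj₁ 1F
      T : Tri [] o p (inj₁ 2F)
      T = t012
      low : ∀ {v i} → level v ≤ 18 ⊎ v ≡ inj₁ i → level v ≤ 18
      low (inj₁ l)    = l
      low (inj₂ refl) = z≤n
      fromCycle : ∀ {i j} → Cycle (inj₁ i) (inj₁ j) (λ v → level v ≤ 18) → MonoBistar bistarDepth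
      fromCycle (b , cycle e₁ e₂ e₃ e₄ n n′ i₁ i₂ i₃) = cycle⇒bistar e₁ e₂ e₃ e₄ n′ n z≤n (low i₁) (low i₂) (low i₃)
      finish : Cycle o p (λ v → level v ≤ 18) ⊎ Cycle p o (λ v → level v ≤ 18) → MonoBistar bistarDepth
      finish = [ fromCycle , fromCycle ]′

-- Finite levels

-- The face with address f, meaningful only if f has length n.
face : ∀ n → Addr → Face n
face zero    _       = tt
face (suc n) []      = face n [] , 0F
face (suc n) (j ∷ f) = face n f , j

addr : ∀ n → Face n → Addr
addr zero    _       = []
addr (suc n) (f , j) = j ∷ addr n f

-- Points of level above n get junk values.
vertex : ∀ n → Point → Vtx n
vertex zero    (inj₁ i) = i
vertex zero    (inj₂ f) = 0F
vertex (suc n) (inj₁ i) = inj₁ (vertex n (inj₁ i))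
vertex (suc n) (inj₂ f) with length f ≟ⁿ n
... | yes _ = inj₂ (face n f)
... | no _  = inj₁ (vertex n (inj₂ f))

point : ∀ n → Vtx n → Point
point zero    i        = inj₁ i
point (suc n) (inj₁ v) = point n v
point (suc n) (inj₂ f) = inj₂ (addr n f)

vertex-old : ∀ n p → level p ≤ n → vertex (suc n) p ≡ inj₁ (vertex n p)
vertex-old n (inj₁ i) l = refl
vertex-old n (inj₂ f) l with length f ≟ⁿ n
... | yes refl = ⊥-elim (<-irrefl refl l)
... | no _     = refl

vertex-new : ∀ n f → length f ≡ n → vertex (suc n) (inj₂ f) ≡ inj₂ (face n f)
vertex-new n f eq with length f ≟ⁿ n
... | yes _ = refl
... | no ne = ⊥-elim (ne eq)

addr-face : ∀ n f → length f ≡ n → addr n (face n f) ≡ f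
addr-face zero    []      eq = refl
addr-face (suc n) (j ∷ f) eq = cong (j ∷_) (addr-face n f (suc-injective eq))

point-vertex : ∀ n p → level p ≤ n → point n (vertex n p) ≡ p
point-vertex zero    (inj₁ i) l = refl
point-vertex (suc n) (inj₁ i) l = point-vertex n (inj₁ i) z≤n
point-vertex (suc n) (inj₂ f) (s≤s l) with length f ≟ⁿ n
... | yes eq = cong inj₂ (addr-face n f eq)
... | no ne  = point-vertex n (inj₂ f) (≤∧≢⇒< l ne)

vertex-injective : ∀ {n p q} → level p ≤ n → level q ≤ n → vertex n p ≡ vertex n q → p ≡ q
vertex-injective {n} {p} {q} lp lq eq =
  trans (sym (point-vertex n p lp)) (trans (cong (point n) eq) (point-vertex n q lq))

vertex-vertexOf : ∀ n f i → length f ≡ n → vertex n (vertexOf f i) ≡ corner n (face n f) i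
vertex-vertexOf zero    []      i  eq = refl
vertex-vertexOf (suc n) (j ∷ f) 0F eq with refl ← suc-injective eq =
  trans (vertex-old n _ (level-vertexOf f _)) (cong inj₁ (vertex-vertexOf n f _ refl))
vertex-vertexOf (suc n) (j ∷ f) 1F eq with refl ← suc-injective eq =
  trans (vertex-old n _ (level-vertexOf f _)) (cong inj₁ (vertex-vertexOf n f _ refl))
vertex-vertexOf (suc n) (j ∷ f) 2F eq = vertex-new n f (suc-injective eq)

vertex-spoke : ∀ n f i → length f < n → TrE n (vertex n (inj₂ f)) (vertex n (vertexOf f i))
vertex-spoke (suc n) f i (s≤s l) with length f ≟ⁿ n
... | yes refl rewrite vertex-old n (vertexOf f i) (level-vertexOf f i) | vertex-vertexOf n f i refl = down (face n f) i
... | no ne rewrite vertex-old n (vertexOf f i) (≤-trans (level-vertexOf f i) l) =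
  old (vertex-spoke n f i (≤∧≢⇒< l ne))

vertex-base : ∀ n {i j} → i ≢ j → TrE n (vertex n (inj₁ i)) (vertex n (inj₁ j))
vertex-base zero    p = base p
vertex-base (suc n) p = old (vertex-base n p)

vertex-Adj : ∀ {n p q} → Adj p q → level p ≤ n → level q ≤ n → TrE n (vertex n p) (vertex n q)
vertex-Adj (base p)   lp lq = vertex-base _ p
vertex-Adj (down f i) lp lq = vertex-spoke _ f i lp
vertex-Adj {n} (up f i) lp lq = E-sym (Tr n) (vertex-spoke n f i lq)

pulledBack : ∀ {n} → Colouring (Tr n) → Point → Point → Bool
pulledBack {n} c p q = col c (vertex n p) (vertex n q)

monoCopy : ∀ {n VH} {H : Graph VH} (c : Colouring (Tr n)) {b} (emb : VH → Point) →
  (∀ i → level (emb i) ≤ n) → (∀ i j → emb i ≡ emb j → i ≡ j) →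
  (∀ {i j} → E H i j → Adj (emb i) (emb j) × pulledBack c (emb i) (emb j) ≡ b) → MonoCopy (Tr n) c b H
monoCopy {n} c emb low inj edge = record
  { emb     = λ i → vertex n (emb i)
  ; emb-inj = λ eq → inj _ _ (vertex-injective (low _) (low _) eq)
  ; emb-E   = λ e → vertex-Adj (proj₁ (edge e)) (low _) (low _)
  ; emb-col = λ e → proj₂ (edge e) }

restrict : ∀ {n VH VL b} {H : Graph VH} {L : Graph VL} {c : Colouring (Tr n)} →
  L ⊆G H → MonoCopy (Tr n) c b H → MonoCopy (Tr n) c b L
restrict s m = record
  { emb     = λ i → M.emb (S.emb i)
  ; emb-inj = λ eq → S.emb-inj (M.emb-inj eq)
  ; emb-E   = λ e → M.emb-E (S.emb-E e)
  ; emb-col = λ e → M.emb-col (S.emb-E e) }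
  where
    module S = _⊆G_ s
    module M = MonoCopy m

-- Forcing jellyfish, bistars and their subgraphs in Tr(n)

Tr⟶Jelly : ∀ k → ∃[ n ] (Tr n ⟶ Jelly k)
Tr⟶Jelly k = depth , arrow
  where
    depth : ℕ
    depth = JellyDepths.jellyDepth k 18
    arrow : Tr depth ⟶ Jelly k
    arrow c = J.colour , monoCopy c J.emb J.low J.emb-≡ edge
      where
        c-sym : ∀ p q → pulledBack c p q ≡ pulledBack c q p
        c-sym p q = col-sym c _ _
        module Js = Jellies k depth (pulledBack c) c-sym
        open Coloured (pulledBack c) c-sym using (flip)
        module J = Js.MonoJelly (Js.jelly 18 Js.fanPetal {f = []} t012 z≤n
          (λ i → ≤-trans (inside-level≤ i) (≤-reflexive (+-identityʳ _))))
        edge : ∀ {i j} → JE k i j ⊎ JE k j i → Adj (J.emb i) (J.emb j) × pulledBack c (J.emb i) (J.emb j) ≡ J.colour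
        edge (inj₁ e) = J.emb-E e
        edge (inj₂ e) = flip (J.emb-E e)

Tr⟶Bistar : ∀ k → ∃[ n ] (Tr n ⟶ Bistar k)
Tr⟶Bistar k = depth , arrow
  where
    depth : ℕ
    depth = BistarDepths.bistarDepth k
    arrow : Tr depth ⟶ Bistar k
    arrow c = B.colour , monoCopy c B.emb B.low B.emb-≡ edge
      where
        c-sym : ∀ p q → pulledBack c p q ≡ pulledBack c q p
        c-sym p q = col-sym c _ _
        module Bs = Bistars k (pulledBack c) c-sym
        open Coloured (pulledBack c) c-sym using (flip)
        module B = Bs.MonoBistar Bs.bistar
        edge : ∀ {i j} → BE k i j ⊎ BE k j i → Adj (B.emb i) (B.emb j) × pulledBack c (B.emb i) (B.emb j) ≡ B.colour
        edge (inj₁ e) = B.emb-E e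
        edge (inj₂ e) = flip (B.emb-E e)

unavoidable : ∀ {m} {L : Graph (Fin m)} → ∃[ k ] (1 ≤ k × (L ⊆G Jelly k ⊎ L ⊆G Bistar k)) → ∃[ n ] (Tr n ⟶ L)
unavoidable (k , _ , inj₁ s) = let n , a = Tr⟶Jelly k in n , λ c → let b , m = a c in b , restrict s m
unavoidable (k , _ , inj₂ s) = let n , a = Tr⟶Bistar k in n , λ c → let b , m = a c in b , restrict s m

-- Graphs of radius two that avoid the three patterns

≢-≢⇒≡ : ∀ {a b c : Bool} → a ≢ b → c ≢ b → a ≡ c
≢-≢⇒≡ {false} {false} p q = ⊥-elim (p refl)
≢-≢⇒≡ {false} {true} {false} p q = refl
≢-≢⇒≡ {false} {true} {true}  p q = ⊥-elim (q refl)
≢-≢⇒≡ {true} {true} p q = ⊥-elim (p refl)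
≢-≢⇒≡ {true} {false} {true}  p q = refl
≢-≢⇒≡ {true} {false} {false} p q = ⊥-elim (q refl)

module Structure {m : ℕ} (R : Fin m → Fin m → Set) (R? : ∀ u v → Dec (R u v))
  (R-sym : ∀ {u v} → R u v → R v u)
  (χ : Fin m → Bool) (proper : ∀ {u v} → R u v → χ u ≢ χ v)
  (noK₂₃ : ∀ {x y a b c} → x ≢ y → a ≢ b → b ≢ c → a ≢ c →
    R x a → R x b → R x c → R y a → R y b → R y c → ⊥)
  (noTwoPendants : ∀ {x y z w p q} → x ≢ z → y ≢ w → R x y → R y z → R z w → R w x →
    R x p → p ≢ y → p ≢ w → R y q → q ≢ x → q ≢ z → ⊥)
  (o : Fin m) (near : ∀ u → u ≡ o ⊎ R o u ⊎ ∃[ w ] R o w × R w u) where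

  irrefl : ∀ {u} → ¬ R u u
  irrefl r = proper r refl

  -- A non-neighbour of `o` is `o` itself or at the end of a walk of length two from `o`. Hence
  -- every edge joins a neighbour of `o` to a non-neighbour.
  even : ∀ {u} → ¬ R o u → χ u ≡ χ o
  even {u} nou with near u
  ... | inj₁ refl = refl
  ... | inj₂ (inj₁ r) = ⊥-elim (nou r)
  ... | inj₂ (inj₂ (w , ow , wu)) = ≢-≢⇒≡ (λ eq → proper wu (sym eq)) (proper ow)

  neighbour-odd : ∀ {u v} → ¬ R o u → R u v → R o v
  neighbour-odd {u} {v} nou r with R? o v
  ... | yes ov = ov
  ... | no nov = ⊥-elim (proper r (trans (even nou) (sym (even nov))))

  odd-neighbour : ∀ {u v} → R o u → R u v → ¬ R o v
  odd-neighbour ou uv ov = proper uv (≢-≢⇒≡ (λ eq → proper ou (sym eq)) (λ eq → proper ov (sym eq)))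

  -- `Place` is a relation so that a place carries the reasons for its choice, on which `half` can
  -- match. Edges need checking in one direction only, from a non-neighbour of `o` to a neighbour.
  module Embedding {B : Set} (E : B → B → Set) (E-sym : ∀ {a b} → E a b → E b a) (Place : Fin m → B → Set)
    (half : ∀ {u v p q} → ¬ R o u → R o v → R u v → Place u p → Place v q → E p q) where

    edge : ∀ {u v p q} → R u v → Place u p → Place v q → E p q
    edge {u} r pu pv with R? o u
    ... | yes ou = E-sym (half (odd-neighbour ou r) ou (R-sym r) pv pu)
    ... | no nou = half nou (neighbour-odd nou r) r pu pv

  -- A 4-cycle `o n₁ z n₂` with a further edge `n₁ p`. Its presence leads to a bistar, its absence
  -- to a jellyfish.
  Pendant : Set
  Pendant = ∃[ n₁ ] ∃[ n₂ ] ∃[ z ] ∃[ p ]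
    (R o n₁ × R o n₂ × n₁ ≢ n₂ × R n₁ z × R n₂ z × z ≢ o × R n₁ p × p ≢ z × p ≢ o)

  pendant? : Dec Pendant
  pendant? = Fin.any? λ n₁ → Fin.any? λ n₂ → Fin.any? λ z → Fin.any? λ p →
    R? o n₁ ×-dec R? o n₂ ×-dec ¬? (n₁ ≟ n₂) ×-dec R? n₁ z ×-dec R? n₂ z ×-dec ¬? (z ≟ o)
      ×-dec R? n₁ p ×-dec ¬? (p ≟ z) ×-dec ¬? (p ≟ o)

  module InBistar {n₁ n₂ z p} (on₁ : R o n₁) (on₂ : R o n₂) (n₁≢n₂ : n₁ ≢ n₂) (n₁z : R n₁ z) (n₂z : R n₂ z)
                  (z≢o : z ≢ o) (n₁p : R n₁ p) (p≢z : p ≢ z) (p≢o : p ≢ o) where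

    -- A third neighbour of `o` would give the adjacent cycle vertices `o` and `n₁` a pendant edge
    -- each.
    only : ∀ {q} → R o q → q ≡ n₁ ⊎ q ≡ n₂
    only {q} oq with q ≟ n₁ | q ≟ n₂
    ... | yes eq | _ = inj₁ eq
    ... | _ | yes eq = inj₂ eq
    ... | no ne | no ne′ = ⊥-elim (noTwoPendants (λ eq → z≢o (sym eq)) n₁≢n₂ on₁ n₁z (R-sym n₂z) (R-sym on₂)
                                     oq ne ne′ n₁p p≢o p≢z)

    -- The centres are `n₁` and `n₂`. A leaf is indexed by the vertex placed there, so distinctness
    -- is immediate; `suc` only fits the index to `k = suc m`, which is positive.
    data Place (u : Fin m) : BV (suc m) → Set where
      atO   : u ≡ o  → Place u (c4 1F)
      atN₁  : u ≡ n₁ → Place u (c4 0F)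
      atN₂  : u ≡ n₂ → Place u (c4 2F)
      atZ   : u ≡ z  → Place u (c4 3F)
      left  : ¬ R o u → u ≢ o → u ≢ z → R n₁ u → Place u (leafA (suc u))
      right : ¬ R o u → u ≢ o → u ≢ z → ¬ R n₁ u → Place u (leafB (suc u))

    place : ∀ u → ∃[ b ] Place u b
    place u with u ≟ o | R? o u | u ≟ z | R? n₁ u
    ... | yes eq | _ | _ | _ = _ , atO eq
    ... | _ | yes ou | _ | _ = [ (λ eq → _ , atN₁ eq) , (λ eq → _ , atN₂ eq) ]′ (only ou)
    ... | _ | _ | yes eq | _ = _ , atZ eq
    ... | no ne | no nou | no ne′ | yes r = _ , left nou ne ne′ r
    ... | no ne | no nou | no ne′ | no nr = _ , right nou ne ne′ nr

    place-injective : ∀ {u v b} → Place u b → Place v b → u ≡ v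
    place-injective (atO p) (atO q) = trans p (sym q)
    place-injective (atN₁ p) (atN₁ q) = trans p (sym q)
    place-injective (atN₂ p) (atN₂ q) = trans p (sym q)
    place-injective (atZ p) (atZ q) = trans p (sym q)
    place-injective (left _ _ _ _) (left _ _ _ _) = refl
    place-injective (right _ _ _ _) (right _ _ _ _) = refl

    half : ∀ {u v b c} → ¬ R o u → R o v → R u v → Place u b → Place v c → E (Bistar (suc m)) b c
    half nou ov uv (atN₁ refl) pv = ⊥-elim (nou on₁)
    half nou ov uv (atN₂ refl) pv = ⊥-elim (nou on₂)
    half nou ov uv pu (atO refl) = ⊥-elim (irrefl ov)
    half nou ov uv pu (atZ refl) = ⊥-elim (odd-neighbour on₁ n₁z ov)
    half nou ov uv pu (left nov _ _ _) = ⊥-elim (nov ov)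
    half nou ov uv pu (right nov _ _ _) = ⊥-elim (nov ov)
    half nou ov uv (atO refl) (atN₁ refl) = inj₂ e01
    half nou ov uv (atO refl) (atN₂ refl) = inj₁ e12
    half nou ov uv (atZ refl) (atN₁ refl) = inj₁ e30
    half nou ov uv (atZ refl) (atN₂ refl) = inj₂ e23
    half nou ov uv (left _ _ _ _) (atN₁ refl) = inj₂ (sA _)
    -- A vertex adjacent to both centres would be their third common neighbour besides `o` and `z`.
    half nou ov uv (left _ u≢o u≢z n₁u) (atN₂ refl) =
      ⊥-elim (noK₂₃ n₁≢n₂ (λ eq → z≢o (sym eq)) (λ eq → u≢z (sym eq)) (λ eq → u≢o (sym eq))
        (R-sym on₁) n₁z n₁u (R-sym on₂) n₂z (R-sym uv))
    half nou ov uv (right _ _ _ nr) (atN₁ refl) = ⊥-elim (nr (R-sym uv))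
    half nou ov uv (right _ _ _ _) (atN₂ refl) = inj₂ (sB _)

    embedding : ∀ {L : Graph (Fin m)} → (∀ {u v} → E L u v → R u v) → L ⊆G Bistar (suc m)
    embedding sub = record
      { emb     = λ u → proj₁ (place u)
      ; emb-inj = λ {u} {v} eq → place-injective (subst (Place u) eq (proj₂ (place u))) (proj₂ (place v))
      ; emb-E   = λ e → Embedding.edge (E (Bistar (suc m))) (E-sym (Bistar (suc m))) Place half
                          (sub e) (proj₂ (place _)) (proj₂ (place _)) }

  module InJelly (noPendant : ¬ Pendant) where

    Twin : Fin m → Fin m → Fin m → Set
    Twin u z u′ = R o u × R u z × z ≢ o × R o u′ × R u′ z

    -- A petal is indexed by its vertex opposite to the root, and the order of `Fin m` decides which
    -- of the two twins comes first.
    data Place (u : Fin m) : JV (suc m) → Set where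
      atRoot  : u ≡ o → Place u root
      asChild : R o u → (∀ {z u′} → u ≢ u′ → ¬ Twin u z u′) → Place u (child (suc u))
      asFirst : ∀ {z u′} → Twin u z u′ → u <ᶠ u′ → Place u (petal (suc z) 0F)
      asLast  : ∀ {z u′} → Twin u z u′ → u′ <ᶠ u → Place u (petal (suc z) 2F)
      asMid   : ∀ {w w′} → ¬ R o u → u ≢ o → R o w → R w u → R o w′ → R w′ u → w ≢ w′ → Place u (petal (suc u) 1F)
      asLeaf  : ∀ {w} → ¬ R o u → u ≢ o → R o w → R w u → (∀ {w′} → R o w′ → R w′ u → w′ ≡ w) →
                Place u (gchild (suc w) (suc u))

    twin? : ∀ u → Dec (∃[ z ] ∃[ u′ ] (u ≢ u′ × Twin u z u′))
    twin? u = Fin.any? λ z → Fin.any? λ u′ →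
      ¬? (u ≟ u′) ×-dec R? o u ×-dec R? u z ×-dec ¬? (z ≟ o) ×-dec R? o u′ ×-dec R? u′ z

    parent? : ∀ u w → Dec (∃[ w′ ] (w ≢ w′ × R o w′ × R w′ u))
    parent? u w = Fin.any? λ w′ → ¬? (w ≟ w′) ×-dec R? o w′ ×-dec R? w′ u

    placeOdd : ∀ {u} → R o u → ∃[ b ] Place u b
    placeOdd {u} ou with twin? u
    ... | no none = _ , asChild ou (λ ne t → none (_ , _ , ne , t))
    ... | yes (z , u′ , ne , t) with Fin.<-cmp u u′
    ... | tri< lt _ _ = _ , asFirst t lt
    ... | tri≈ _ eq _ = ⊥-elim (ne eq)
    ... | tri> _ _ gt = _ , asLast t gt

    placeEven : ∀ {u w} → ¬ R o u → u ≢ o → R o w → R w u → ∃[ b ] Place u b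
    placeEven {u} {w} nou ne ow wu with parent? u w
    ... | yes (w′ , ne′ , ow′ , w′u) = _ , asMid nou ne ow wu ow′ w′u ne′
    ... | no none = _ , asLeaf nou ne ow wu unique
      where
        unique : ∀ {w′} → R o w′ → R w′ u → w′ ≡ w
        unique {w′} ow′ w′u with w ≟ w′
        ... | yes eq = sym eq
        ... | no ne′ = ⊥-elim (none (w′ , ne′ , ow′ , w′u))

    place : ∀ u → ∃[ b ] Place u b
    place u with u ≟ o | R? o u | near u
    ... | yes eq | _ | _ = _ , atRoot eq
    ... | no _ | yes ou | _ = placeOdd ou
    ... | no ne | no nou | inj₁ eq = ⊥-elim (ne eq)
    ... | no ne | no nou | inj₂ (inj₁ ou) = ⊥-elim (nou ou)
    ... | no ne | no nou | inj₂ (inj₂ (w , ow , wu)) = placeEven nou ne ow wu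

    -- Otherwise `u`, `u′` and `v` would be three common neighbours of `o` and `z`.
    sameTwins : ∀ {u v u′ v′ z} → u ≢ v → u ≢ u′ → Twin u z u′ → Twin v z v′ → u′ ≡ v
    sameTwins {u} {v} {u′} u≢v u≢u′ (ou , uz , z≢o , ou′ , u′z) (ov , vz , _) with u′ ≟ v
    ... | yes eq = eq
    ... | no ne = ⊥-elim (noK₂₃ (λ eq → z≢o (sym eq)) u≢u′ ne u≢v ou ou′ ov (R-sym uz) (R-sym u′z) (R-sym vz))

    twin-< : ∀ {u v u′ v′ z} → Twin u z u′ → Twin v z v′ → u <ᶠ u′ → v <ᶠ v′ → u ≡ v
    twin-< {u} {v} tu tv lt lt′ with u ≟ v
    ... | yes eq = eq
    ... | no ne = ⊥-elim (Fin.<-asym (subst (u <ᶠ_) (sameTwins ne (Fin.<⇒≢ lt) tu tv) lt)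
                    (subst (v <ᶠ_) (sameTwins (λ eq → ne (sym eq)) (Fin.<⇒≢ lt′) tv tu) lt′))

    twin-> : ∀ {u v u′ v′ z} → Twin u z u′ → Twin v z v′ → u′ <ᶠ u → v′ <ᶠ v → u ≡ v
    twin-> {u} {v} tu tv gt gt′ with u ≟ v
    ... | yes eq = eq
    ... | no ne = ⊥-elim (Fin.<-asym (subst (_<ᶠ u) (sameTwins ne (λ eq → Fin.<⇒≢ gt (sym eq)) tu tv) gt)
                    (subst (_<ᶠ v) (sameTwins (λ eq → ne (sym eq)) (λ eq → Fin.<⇒≢ gt′ (sym eq)) tv tu) gt′))

    place-injective : ∀ {u v b} → Place u b → Place v b → u ≡ v
    place-injective (atRoot p) (atRoot q) = trans p (sym q)
    place-injective (asChild _ _) (asChild _ _) = refl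
    place-injective (asFirst t lt) (asFirst t′ lt′) = twin-< t t′ lt lt′
    place-injective (asLast t gt) (asLast t′ gt′) = twin-> t t′ gt gt′
    place-injective (asMid _ _ _ _ _ _ _) (asMid _ _ _ _ _ _ _) = refl
    place-injective (asLeaf _ _ _ _ _) (asLeaf _ _ _ _ _) = refl

    otherParent : ∀ {u v w w′} → R o w → R w u → R o w′ → R w′ u → w ≢ w′ → ∃[ x ] (v ≢ x × R o x × R x u)
    otherParent {v = v} {w} {w′} ow wu ow′ w′u ne with v ≟ w
    ... | no ne′ = w , ne′ , ow , wu
    ... | yes refl = w′ , ne , ow′ , w′u

    -- A second neighbour of `v` apart from `o` would be a pendant at the 4-cycle `o v z v′`.
    onlyTwin : ∀ {u v z v′} → ¬ R o u → u ≢ o → R u v → v ≢ v′ → Twin v z v′ → u ≡ z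
    onlyTwin {u} {z = z} nou ne uv v≢v′ (ov , vz , z≢o , ov′ , v′z) with u ≟ z
    ... | yes eq = eq
    ... | no ne′ = ⊥-elim (noPendant (_ , _ , _ , _ , ov , ov′ , v≢v′ , vz , v′z , z≢o , R-sym uv , ne′ , ne))

    half : ∀ {u v b c} → ¬ R o u → R o v → R u v → Place u b → Place v c → E (Jelly (suc m)) b c
    half nou ov uv (asChild ou _) pv = ⊥-elim (nou ou)
    half nou ov uv (asFirst t _) pv = ⊥-elim (nou (proj₁ t))
    half nou ov uv (asLast t _) pv = ⊥-elim (nou (proj₁ t))
    half nou ov uv pu (atRoot refl) = ⊥-elim (irrefl ov)
    half nou ov uv pu (asMid nov _ _ _ _ _ _) = ⊥-elim (nov ov)
    half nou ov uv pu (asLeaf nov _ _ _ _) = ⊥-elim (nov ov)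
    half nou ov uv (atRoot refl) (asChild _ _) = inj₁ (t1 _)
    half nou ov uv (atRoot refl) (asFirst _ _) = inj₁ (p0 _)
    half nou ov uv (atRoot refl) (asLast _ _) = inj₂ (p3 _)
    -- One of the two parents of `u` differs from `v` and is therefore a twin of `v`.
    half nou ov uv (asMid _ ne ow wu ow′ w′u w≢w′) (asChild _ none) =
      let x , v≢x , ox , xu = otherParent ow wu ow′ w′u w≢w′
      in ⊥-elim (none v≢x (ov , R-sym uv , ne , ox , xu))
    half nou ov uv (asMid _ ne _ _ _ _ _) (asFirst t lt) with refl ← onlyTwin nou ne uv (Fin.<⇒≢ lt) t = inj₂ (p1 _)
    half nou ov uv (asMid _ ne _ _ _ _ _) (asLast t gt)
      with refl ← onlyTwin nou ne uv (λ eq → Fin.<⇒≢ gt (sym eq)) t = inj₁ (p2 _)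
    half nou ov uv (asLeaf _ ne ow wu unique) (asChild _ _) with refl ← unique ov (R-sym uv) = inj₂ (t2 _ _)
    -- The leaf would be the middle of a petal and so have two parents.
    half nou ov uv (asLeaf _ ne ow wu unique) (asFirst t lt)
      with refl ← onlyTwin nou ne uv (Fin.<⇒≢ lt) t | _ , _ , _ , ov′ , v′z ← t =
      ⊥-elim (Fin.<⇒≢ lt (trans (unique ov (R-sym uv)) (sym (unique ov′ v′z))))
    half nou ov uv (asLeaf _ ne ow wu unique) (asLast t gt)
      with refl ← onlyTwin nou ne uv (λ eq → Fin.<⇒≢ gt (sym eq)) t | _ , _ , _ , ov′ , v′z ← t =
      ⊥-elim (Fin.<⇒≢ gt (trans (unique ov′ v′z) (sym (unique ov (R-sym uv)))))

    embedding : ∀ {L : Graph (Fin m)} → (∀ {u v} → E L u v → R u v) → L ⊆G Jelly (suc m)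
    embedding sub = record
      { emb     = λ u → proj₁ (place u)
      ; emb-inj = λ {u} {v} eq → place-injective (subst (Place u) eq (proj₂ (place u))) (proj₂ (place v))
      ; emb-E   = λ e → Embedding.edge (E (Jelly (suc m))) (E-sym (Jelly (suc m))) Place half
                          (sub e) (proj₂ (place _)) (proj₂ (place _)) }

  embeds : ∀ {L : Graph (Fin m)} → (∀ {u v} → E L u v → R u v) → L ⊆G Jelly (suc m) ⊎ L ⊆G Bistar (suc m)
  embeds sub with pendant?
  ... | yes (_ , _ , _ , _ , on₁ , on₂ , ne , n₁z , n₂z , z≢o , n₁p , p≢z , p≢o) =
    inj₂ (InBistar.embedding on₁ on₂ ne n₁z n₂z z≢o n₁p p≢z p≢o sub)
  ... | no none = inj₁ (InJelly.embedding none sub)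

-- Decidable adjacency and the corners of a face in Tr(n)

mutual
  _≟ⱽ_ : ∀ {n} (u v : Vtx n) → Dec (u ≡ v)
  _≟ⱽ_ {zero}  = _≟_
  _≟ⱽ_ {suc n} = Sum.≡-dec _≟ⱽ_ _≟ꟳ_

  _≟ꟳ_ : ∀ {n} (f g : Face n) → Dec (f ≡ g)
  _≟ꟳ_ {zero}  = Unit._≟_
  _≟ꟳ_ {suc n} = Product.≡-dec _≟ꟳ_ _≟_

TrE⇒≢ : ∀ {n u v} → TrE n u v → u ≢ v
TrE⇒≢ {n} e refl = E-irr (Tr n) e

TrE? : ∀ n u v → Dec (TrE n u v)
TrE? zero    u        v        = map′ base TrE⇒≢ (¬? (u ≟ v))
TrE? (suc n) (inj₁ u) (inj₁ v) = map′ old (λ { (old e) → e }) (TrE? n u v)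
TrE? (suc n) (inj₂ f) (inj₁ v) =
  map′ (λ { (i , refl) → down f i }) (λ { (down f i) → i , refl }) (Fin.any? λ i → corner n f i ≟ⱽ v)
TrE? (suc n) (inj₁ v) (inj₂ f) =
  map′ (λ { (i , refl) → up f i }) (λ { (up f i) → i , refl }) (Fin.any? λ i → corner n f i ≟ⱽ v)
TrE? (suc n) (inj₂ f) (inj₂ g) = no λ ()

corners-adjacent : ∀ n f {i j} → i ≢ j → TrE n (corner n f i) (corner n f j)
corners-adjacent zero    f       p = base p
corners-adjacent (suc n) (f , k) {0F} {0F} p = ⊥-elim (p refl)
corners-adjacent (suc n) (f , k) {0F} {1F} p = old (corners-adjacent n f (pick-≢ k))
corners-adjacent (suc n) (f , k) {0F} {2F} p = up f _
corners-adjacent (suc n) (f , k) {1F} {0F} p = old (corners-adjacent n f (λ eq → pick-≢ k (sym eq)))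
corners-adjacent (suc n) (f , k) {1F} {1F} p = ⊥-elim (p refl)
corners-adjacent (suc n) (f , k) {1F} {2F} p = up f _
corners-adjacent (suc n) (f , k) {2F} {0F} p = down f _
corners-adjacent (suc n) (f , k) {2F} {1F} p = down f _
corners-adjacent (suc n) (f , k) {2F} {2F} p = ⊥-elim (p refl)

corner-injective : ∀ n f {i j} → corner n f i ≡ corner n f j → i ≡ j
corner-injective n f {i} {j} eq with i ≟ j
... | yes i≡j = i≡j
... | no ne = ⊥-elim (TrE⇒≢ (corners-adjacent n f ne) eq)

-- Settles the base cases below, where the triangle Tr(0) is too small for the pattern; proved by
-- exhaustion.
noFourInFin3 : ∀ {a b c d : Fin 3} → a ≢ b → a ≢ c → a ≢ d → b ≢ c → b ≢ d → c ≢ d → ⊥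
noFourInFin3 = toWitness {a? =
  Fin.all? λ a → Fin.all? λ b → Fin.all? λ c → Fin.all? λ d →
    ¬? (a ≟ b) →-dec ¬? (a ≟ c) →-dec ¬? (a ≟ d) →-dec ¬? (b ≟ c) →-dec ¬? (b ≟ d) →-dec ¬? (c ≟ d) →-dec no (λ ())}
  tt _ _ _ _

Mono : ∀ {n} → Colouring (Tr n) → Bool → Vtx n → Vtx n → Set
Mono {n} c b u v = TrE n u v × col c u v ≡ b

mono-sym : ∀ {n} (c : Colouring (Tr n)) {b u v} → Mono c b u v → Mono c b v u
mono-sym {n} c (e , p) = E-sym (Tr n) e , trans (col-sym c _ _) p

-- Bipartite colour classes from the proper 4-colouring by (ℤ/2)², in which the new vertex of a face
-- gets the sum of the colours of its corners.

fourColour : ∀ n → Vtx n → Bool × Bool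
fourColour zero    0F = false , false
fourColour zero    1F = false , true
fourColour zero    2F = true , false
fourColour (suc n) (inj₁ v) = fourColour n v
fourColour (suc n) (inj₂ f) =
  let a , a′ = fourColour n (corner n f 0F) ; b , b′ = fourColour n (corner n f 1F) ; c , c′ = fourColour n (corner n f 2F)
  in a xor b xor c , a′ xor b′ xor c′

fourColour-base : ∀ {u v} → fourColour 0 u ≡ fourColour 0 v → u ≡ v
fourColour-base {0F} {0F} eq = refl
fourColour-base {0F} {1F} ()
fourColour-base {0F} {2F} ()
fourColour-base {1F} {0F} ()
fourColour-base {1F} {1F} eq = refl
fourColour-base {1F} {2F} ()
fourColour-base {2F} {0F} ()
fourColour-base {2F} {1F} ()
fourColour-base {2F} {2F} eq = refl

xor-cancel : ∀ a b c → a xor b xor c ≡ a → b ≡ c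
xor-cancel false false c     eq = sym eq
xor-cancel false true  true  eq = refl
xor-cancel true  false false eq = refl
xor-cancel true  true  true  eq = refl

xor-swap : ∀ a b c → a xor b xor c ≡ b → a ≡ c
xor-swap false false false eq = refl
xor-swap false true  false eq = refl
xor-swap true  false true  eq = refl
xor-swap true  true  true  eq = refl

xor-last : ∀ a b c → a xor b xor c ≡ c → a ≡ b
xor-last false false c     eq = refl
xor-last true  true  c     eq = refl
xor-last false true  false ()
xor-last false true  true  ()
xor-last true  false false ()
xor-last true  false true  ()

-- The sum of the three corner colours equals one of them only if the other two agree, and those
-- belong to adjacent corners.
fourColour-proper : ∀ {n u v} → TrE n u v → fourColour n u ≢ fourColour n v
fourColour-spoke : ∀ n f i → fourColour (suc n) (inj₂ f) ≢ fourColour n (corner n f i)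
fourColour-proper (base p)   eq = p (fourColour-base eq)
fourColour-proper (old e)    eq = fourColour-proper e eq
fourColour-proper (down f i) eq = fourColour-spoke _ f i eq
fourColour-proper (up f i)   eq = fourColour-spoke _ f i (sym eq)
fourColour-spoke n f 0F eq = fourColour-proper (corners-adjacent n f {1F} {2F} λ ())
  (cong₂ _,_ (xor-cancel _ _ _ (cong proj₁ eq)) (xor-cancel _ _ _ (cong proj₂ eq)))
fourColour-spoke n f 1F eq = fourColour-proper (corners-adjacent n f {0F} {2F} λ ())
  (cong₂ _,_ (xor-swap _ _ _ (cong proj₁ eq)) (xor-swap _ _ _ (cong proj₂ eq)))
fourColour-spoke n f 2F eq = fourColour-proper (corners-adjacent n f {0F} {1F} λ ())
  (cong₂ _,_ (xor-last _ _ _ (cong proj₁ eq)) (xor-last _ _ _ (cong proj₂ eq)))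

bipartite : ∀ n → Colouring (Tr n)
bipartite n = record
  { col     = λ u v → proj₁ (fourColour n u) xor proj₁ (fourColour n v)
  ; col-sym = λ u v → xor-comm (proj₁ (fourColour n u)) _ }

part : ∀ {n} → Bool → Vtx n → Bool
part {n} true  v = proj₁ (fourColour n v)
part {n} false v = proj₂ (fourColour n v)

-- In colour `true` the first coordinates differ. In colour `false` they agree, so the second ones
-- differ because the 4-colouring is proper.
part-proper : ∀ {n} b {u v} → Mono (bipartite n) b u v → part {n} b u ≢ part {n} b v
part-proper true  {u} {v} (e , p) eq with trans (sym p) (trans (cong (_xor _) eq) (xor-same (proj₁ (fourColour _ v))))
... | ()
part-proper false (e , p) eq = fourColour-proper e (cong₂ _,_ (xor-cancel false _ _ p) eq)

-- No monochromatic K₂,₃: all spokes of the new vertices of one level have the same colour, alternating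
-- with the level, except for one spoke per vertex, to the corner `spare`.

spare shared apex : ∀ n → Face n → Vtx n
spare  zero    _       = 1F
spare  (suc n) (f , j) = inj₁ (corner n f (next j))
  where
    -- Subface `j` keeps the old corners `j` and `next j`. The cyclic choice gives the three
    -- subfaces different `shared` corners, as `poles-injective` requires.
    next : Fin 3 → Fin 3
    next 0F = 1F
    next 1F = 2F
    next 2F = 0F
shared zero    _       = 0F
shared (suc n) (f , j) = inj₁ (corner n f j)
apex   zero    _       = 2F
apex   (suc n) (f , j) = inj₂ f

corner-cases : ∀ n f i → corner n f i ≡ spare n f ⊎ corner n f i ≡ shared n f ⊎ corner n f i ≡ apex n f
corner-cases zero    f        0F = inj₂ (inj₁ refl)
corner-cases zero    f        1F = inj₁ refl
corner-cases zero    f        2F = inj₂ (inj₂ refl)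
corner-cases (suc n) (f , 0F) 0F = inj₂ (inj₁ refl)
corner-cases (suc n) (f , 1F) 0F = inj₂ (inj₁ refl)
corner-cases (suc n) (f , 2F) 0F = inj₁ refl
corner-cases (suc n) (f , 0F) 1F = inj₁ refl
corner-cases (suc n) (f , 1F) 1F = inj₁ refl
corner-cases (suc n) (f , 2F) 1F = inj₂ (inj₁ refl)
corner-cases (suc n) (f , j)  2F = inj₂ (inj₂ refl)

parity : ℕ → Bool
parity zero    = false
parity (suc n) = not (parity n)

spokeColour : ∀ n → Face n → Vtx n → Bool
spokeColour n f v with v ≟ⱽ spare n f
... | yes _ = not (parity n)
... | no _  = parity n

alternatingCol : ∀ n → Vtx n → Vtx n → Bool
alternatingCol zero    u        v        = true
alternatingCol (suc n) (inj₁ u) (inj₁ v) = alternatingCol n u v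
alternatingCol (suc n) (inj₁ u) (inj₂ f) = spokeColour n f u
alternatingCol (suc n) (inj₂ f) (inj₁ u) = spokeColour n f u
alternatingCol (suc n) (inj₂ f) (inj₂ g) = true

alternatingCol-sym : ∀ n u v → alternatingCol n u v ≡ alternatingCol n v u
alternatingCol-sym zero    u        v        = refl
alternatingCol-sym (suc n) (inj₁ u) (inj₁ v) = alternatingCol-sym n u v
alternatingCol-sym (suc n) (inj₁ u) (inj₂ f) = refl
alternatingCol-sym (suc n) (inj₂ f) (inj₁ u) = refl
alternatingCol-sym (suc n) (inj₂ f) (inj₂ g) = refl

alternating : ∀ n → Colouring (Tr n)
alternating n = record { col = alternatingCol n ; col-sym = alternatingCol-sym n }

old-mono : ∀ {n b u v} → Mono (alternating (suc n)) b (inj₁ u) (inj₁ v) → Mono (alternating n) b u v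
old-mono (old e , p) = e , p

Pole : ∀ n → Face n → Vtx n → Set
Pole n f v = v ≡ shared n f ⊎ v ≡ apex n f

spoke-mono : ∀ {n b f v} → Mono (alternating (suc n)) b (inj₂ f) (inj₁ v) →
  b ≡ not (parity n) × v ≡ spare n f ⊎ b ≡ parity n × Pole n f v
spoke-mono {n} (down f i , p) with corner n f i ≟ⱽ spare n f | corner-cases n f i
... | yes eq | _       = inj₁ (sym p , eq)
... | no _   | inj₂ c  = inj₂ (sym p , c)
... | no ne  | inj₁ eq = ⊥-elim (ne eq)

poles-only : ∀ {n f u v w} → Pole n f u → Pole n f v → Pole n f w → u ≢ v → v ≢ w → u ≢ w → ⊥
poles-only (inj₁ refl) (inj₁ refl) _ n₁ n₂ n₃ = n₁ refl
poles-only (inj₂ refl) (inj₂ refl) _ n₁ n₂ n₃ = n₁ refl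
poles-only _ (inj₁ refl) (inj₁ refl) n₁ n₂ n₃ = n₂ refl
poles-only _ (inj₂ refl) (inj₂ refl) n₁ n₂ n₃ = n₂ refl
poles-only (inj₁ refl) _ (inj₁ refl) n₁ n₂ n₃ = n₃ refl
poles-only (inj₂ refl) _ (inj₂ refl) n₁ n₂ n₃ = n₃ refl

spare-unique : ∀ {n b f u v} → b ≡ not (parity n) → Mono (alternating (suc n)) b (inj₂ f) (inj₁ u) →
  Mono (alternating (suc n)) b (inj₂ f) (inj₁ v) → u ≡ v
spare-unique eq mu mv with spoke-mono mu | spoke-mono mv
... | inj₁ (_ , p) | inj₁ (_ , q) = trans p (sym q)
... | inj₂ (eq′ , _) | _ = ⊥-elim (not-¬ eq′ eq)
... | _ | inj₂ (eq′ , _) = ⊥-elim (not-¬ eq′ eq)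

spokes≤2 : ∀ {n b f u v w} → Mono (alternating (suc n)) b (inj₂ f) u → Mono (alternating (suc n)) b (inj₂ f) v →
  Mono (alternating (suc n)) b (inj₂ f) w → u ≢ v → v ≢ w → u ≢ w → ⊥
spokes≤2 {u = inj₁ u} {inj₁ v} {inj₁ w} mu mv mw n₁ n₂ n₃ with spoke-mono mu | spoke-mono mv | spoke-mono mw
... | inj₁ (eq , _) | _ | _ = n₁ (cong inj₁ (spare-unique eq mu mv))
... | _ | inj₁ (eq , _) | _ = n₁ (cong inj₁ (spare-unique eq mu mv))
... | _ | _ | inj₁ (eq , _) = n₁ (cong inj₁ (spare-unique eq mu mv))
... | inj₂ (_ , p) | inj₂ (_ , q) | inj₂ (_ , r) =
  poles-only p q r (λ eq → n₁ (cong inj₁ eq)) (λ eq → n₂ (cong inj₁ eq)) (λ eq → n₃ (cong inj₁ eq))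

-- At positive levels the apex determines the parent face, and the shared corner determines the
-- subface.
poles-injective : ∀ {n f g u v} → u ≢ v → Pole n f u → Pole n f v → Pole n g u → Pole n g v → f ≡ g
poles-injective ne (inj₁ refl) (inj₁ refl) _ _ = ⊥-elim (ne refl)
poles-injective ne (inj₂ refl) (inj₂ refl) _ _ = ⊥-elim (ne refl)
poles-injective {zero} ne _ _ _ _ = refl
poles-injective {suc n} ne (inj₁ refl) (inj₂ refl) (inj₁ p) (inj₂ refl) =
  cong (_ ,_) (corner-injective n _ (Sum.inj₁-injective p))
poles-injective {suc n} ne (inj₂ refl) (inj₁ refl) (inj₂ refl) (inj₁ p) =
  cong (_ ,_) (corner-injective n _ (Sum.inj₁-injective p))
poles-injective {suc n} ne (inj₁ refl) (inj₂ refl) (inj₁ p) (inj₁ ())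
poles-injective {suc n} ne (inj₁ refl) (inj₂ refl) (inj₂ ()) _
poles-injective {suc n} ne (inj₂ refl) (inj₁ refl) (inj₁ ()) _
poles-injective {suc n} ne (inj₂ refl) (inj₁ refl) (inj₂ p) (inj₂ ())

-- One pole is the apex, inserted one level earlier under the opposite parity, so in colour
-- `parity n` it has only its spare spoke.
noOldCommon : ∀ {n f u v a b} → u ≢ v → Pole n f u → Pole n f v → a ≢ b →
  Mono (alternating n) (parity n) u a → Mono (alternating n) (parity n) u b →
  Mono (alternating n) (parity n) v a → Mono (alternating n) (parity n) v b → ⊥
noOldCommon ne (inj₁ refl) (inj₁ refl) _ _ _ _ _ = ne refl
noOldCommon ne (inj₂ refl) (inj₂ refl) _ _ _ _ _ = ne refl
noOldCommon {zero} ne _ _ ne′ ua ub va vb =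
  noFourInFin3 ne (TrE⇒≢ (proj₁ ua)) (TrE⇒≢ (proj₁ ub)) (TrE⇒≢ (proj₁ va)) (TrE⇒≢ (proj₁ vb)) ne′
noOldCommon {suc n} ne (inj₁ refl) (inj₂ refl) ne′ ua ub va vb = twoSpokes ne′ va vb
  where
    twoSpokes : ∀ {f a b} → a ≢ b → Mono (alternating (suc n)) (not (parity n)) (inj₂ f) a →
      Mono (alternating (suc n)) (not (parity n)) (inj₂ f) b → ⊥
    twoSpokes {a = inj₁ a} {inj₁ b} ne ma mb = ne (cong inj₁ (spare-unique refl ma mb))
noOldCommon {suc n} ne (inj₂ refl) (inj₁ refl) ne′ ua ub va vb =
  noOldCommon {suc n} (λ eq → ne (sym eq)) (inj₁ refl) (inj₂ refl) ne′ va vb ua ub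

-- A newest vertex has at most two spokes of one colour, so it is neither `x` nor `y`. If it is a
-- common neighbour, then `x` and `y` are its poles: it is the only new common neighbour, and
-- `noOldCommon` allows at most one old one.
noK₂₃ : ∀ n {b x y p q r} → x ≢ y → p ≢ q → q ≢ r → p ≢ r →
  Mono (alternating n) b x p → Mono (alternating n) b x q → Mono (alternating n) b x r →
  Mono (alternating n) b y p → Mono (alternating n) b y q → Mono (alternating n) b y r → ⊥
noK₂₃ zero n₀ n₁ n₂ n₃ xp xq xr yp yq yr =
  noFourInFin3 (TrE⇒≢ (proj₁ xp)) (TrE⇒≢ (proj₁ xq)) (TrE⇒≢ (proj₁ xr)) n₁ n₃ n₂
noK₂₃ (suc n) {x = inj₂ f} n₀ n₁ n₂ n₃ xp xq xr yp yq yr = spokes≤2 xp xq xr n₁ n₂ n₃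
noK₂₃ (suc n) {y = inj₂ f} n₀ n₁ n₂ n₃ xp xq xr yp yq yr = spokes≤2 yp yq yr n₁ n₂ n₃
noK₂₃ (suc n) {b} {inj₁ x} {inj₁ y} n₀ = cases
  where
    M : Vtx (suc n) → Vtx (suc n) → Set
    M = Mono (alternating (suc n)) b
    x≢y : x ≢ y
    x≢y eq = n₀ (cong inj₁ eq)
    poles : ∀ {f} → M (inj₁ x) (inj₂ f) → M (inj₁ y) (inj₂ f) → b ≡ parity n × Pole n f x × Pole n f y
    poles xf yf with spoke-mono (mono-sym (alternating (suc n)) xf) | spoke-mono (mono-sym (alternating (suc n)) yf)
    ... | inj₁ (_ , ex)  | inj₁ (_ , ey)   = ⊥-elim (x≢y (trans ex (sym ey)))
    ... | inj₁ (eq , _)  | inj₂ (eq′ , _)  = ⊥-elim (not-¬ eq′ eq)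
    ... | inj₂ (eq′ , _) | inj₁ (eq , _)   = ⊥-elim (not-¬ eq′ eq)
    ... | inj₂ (eq , px) | inj₂ (_ , py)   = eq , px , py
    newest : ∀ {f q r} → inj₂ f ≢ q → q ≢ r → inj₂ f ≢ r →
      M (inj₁ x) (inj₂ f) → M (inj₁ x) q → M (inj₁ x) r → M (inj₁ y) (inj₂ f) → M (inj₁ y) q → M (inj₁ y) r → ⊥
    newest {q = inj₂ g} n₁ n₂ n₃ xp xq xr yp yq yr =
      let _ , px , py = poles xp yp ; _ , px′ , py′ = poles xq yq
      in n₁ (cong inj₂ (poles-injective x≢y px py px′ py′))
    newest {r = inj₂ g} n₁ n₂ n₃ xp xq xr yp yq yr =
      let _ , px , py = poles xp yp ; _ , px′ , py′ = poles xr yr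
      in n₃ (cong inj₂ (poles-injective x≢y px py px′ py′))
    newest {q = inj₁ q} {inj₁ r} n₁ n₂ n₃ xp xq xr yp yq yr with poles xp yp
    ... | refl , px , py = noOldCommon x≢y px py (λ eq → n₂ (cong inj₁ eq))
      (old-mono xq) (old-mono xr) (old-mono yq) (old-mono yr)
    cases : ∀ {p q r} → p ≢ q → q ≢ r → p ≢ r → M (inj₁ x) p → M (inj₁ x) q → M (inj₁ x) r →
      M (inj₁ y) p → M (inj₁ y) q → M (inj₁ y) r → ⊥
    cases {inj₂ f} n₁ n₂ n₃ xp xq xr yp yq yr = newest n₁ n₂ n₃ xp xq xr yp yq yr
    cases {q = inj₂ f} n₁ n₂ n₃ xp xq xr yp yq yr =
      newest (λ eq → n₁ (sym eq)) n₃ n₂ xq xp xr yq yp yr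
    cases {r = inj₂ f} n₁ n₂ n₃ xp xq xr yp yq yr =
      newest (λ eq → n₂ (sym eq)) (λ eq → n₁ (sym eq)) (λ eq → n₃ (sym eq)) xr xq xp yr yq yp
    cases {inj₁ p} {inj₁ q} {inj₁ r} n₁ n₂ n₃ xp xq xr yp yq yr =
      noK₂₃ n x≢y (λ eq → n₁ (cong inj₁ eq)) (λ eq → n₂ (cong inj₁ eq)) (λ eq → n₃ (cong inj₁ eq))
        (old-mono xp) (old-mono xq) (old-mono xr) (old-mono yp) (old-mono yq) (old-mono yr)

-- No monochromatic 4-cycle has two adjacent vertices of degree at least 3: each vertex has a type, new vertices
-- get the minority type of the corners of their face, and an edge gets the type of its older endpoint.

majority : Bool → Bool → Bool → Bool
majority a b c = a ∧ b ∨ b ∧ c ∨ a ∧ c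

type : ∀ n → Vtx n → Bool
type zero    0F = true
type zero    1F = true
type zero    2F = false
type (suc n) (inj₁ v) = type n v
type (suc n) (inj₂ f) = not (majority (type n (corner n f 0F)) (type n (corner n f 1F)) (type n (corner n f 2F)))

byOlderCol : ∀ n → Vtx n → Vtx n → Bool
byOlderCol zero    u        v        = true
byOlderCol (suc n) (inj₁ u) (inj₁ v) = byOlderCol n u v
byOlderCol (suc n) (inj₁ u) (inj₂ f) = type n u
byOlderCol (suc n) (inj₂ f) (inj₁ u) = type n u
byOlderCol (suc n) (inj₂ f) (inj₂ g) = true

byOlderCol-sym : ∀ n u v → byOlderCol n u v ≡ byOlderCol n v u
byOlderCol-sym zero    u        v        = refl
byOlderCol-sym (suc n) (inj₁ u) (inj₁ v) = byOlderCol-sym n u v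
byOlderCol-sym (suc n) (inj₁ u) (inj₂ f) = refl
byOlderCol-sym (suc n) (inj₂ f) (inj₁ u) = refl
byOlderCol-sym (suc n) (inj₂ f) (inj₂ g) = refl

byOlder : ∀ n → Colouring (Tr n)
byOlder n = record { col = byOlderCol n ; col-sym = byOlderCol-sym n }

older-mono : ∀ {n b u v} → Mono (byOlder (suc n)) b (inj₁ u) (inj₁ v) → Mono (byOlder n) b u v
older-mono (old e , p) = e , p

minority : ∀ n f {i j} → i ≢ j → type n (corner n f i) ≡ type n (corner n f j) →
  type (suc n) (inj₂ f) ≢ type n (corner n f i)
minority n f {i} {j} ne eq = go i j ne eq
  where
    τ : Fin 3 → Bool
    τ i = type n (corner n f i)
    first : ∀ a b c → a ≡ b → not (majority a b c) ≢ a
    first false false false refl ()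
    first false false true  refl ()
    first true  true  c     refl ()
    middle : ∀ a b c → b ≡ c → not (majority a b c) ≢ b
    middle false false false refl ()
    middle false true  true  refl ()
    middle true  false false refl ()
    middle true  true  true  refl ()
    outer : ∀ a b c → a ≡ c → not (majority a b c) ≢ a
    outer false false false refl ()
    outer false true  false refl ()
    outer true  false true  refl ()
    outer true  true  true  refl ()
    go : ∀ i j → i ≢ j → τ i ≡ τ j → type (suc n) (inj₂ f) ≢ τ i
    go 0F 0F p q = ⊥-elim (p refl)
    go 0F 1F p q = first _ _ _ q
    go 0F 2F p q = outer _ (τ 1F) _ q
    go 1F 0F p q = λ r → first _ _ (τ 2F) (sym q) (trans r q)
    go 1F 1F p q = ⊥-elim (p refl)
    go 1F 2F p q = middle (τ 0F) _ _ q
    go 2F 0F p q = λ r → outer _ (τ 1F) _ (sym q) (trans r q)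
    go 2F 1F p q = λ r → middle (τ 0F) _ _ (sym q) (trans r q)
    go 2F 2F p q = ⊥-elim (p refl)

new-type : ∀ {n b f u v} → TrE (suc n) (inj₂ f) (inj₁ u) → TrE (suc n) (inj₂ f) (inj₁ v) → u ≢ v →
  type n u ≡ b → type n v ≡ b → type (suc n) (inj₂ f) ≢ b
new-type {n} (down f i) (down f j) ne refl q = minority n f (λ eq → ne (cong (corner n f) eq)) (sym q)

-- The newest vertex of a triangle has the minority type, so it differs from the other two if they
-- agree.
mixedTriangle : ∀ n {b u v w} → TrE n u v → TrE n v w → TrE n u w → type n u ≡ b → type n v ≡ b → type n w ≡ b → ⊥
mixedTriangle zero {u = u} {v} {w} uv vw uw p q r = base-mixed u v w (TrE⇒≢ uv) (TrE⇒≢ vw) (TrE⇒≢ uw) (trans p (sym q)) (trans q (sym r))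
  where
    base-mixed : ∀ u v w → u ≢ v → v ≢ w → u ≢ w → type 0 u ≡ type 0 v → type 0 v ≡ type 0 w → ⊥
    base-mixed u v w p q r with u | v | w
    ... | 0F | 0F | _  = ⊥-elim (p refl)
    ... | 1F | 1F | _  = ⊥-elim (p refl)
    ... | 2F | 2F | _  = ⊥-elim (p refl)
    ... | _  | 0F | 0F = ⊥-elim (q refl)
    ... | _  | 1F | 1F = ⊥-elim (q refl)
    ... | 0F | _  | 0F = ⊥-elim (r refl)
    ... | 1F | _  | 1F = ⊥-elim (r refl)
    ... | 0F | 1F | 2F = λ _ ()
    ... | 1F | 0F | 2F = λ _ ()
    ... | 0F | 2F | _  = λ ()
    ... | 1F | 2F | _  = λ ()
    ... | 2F | 0F | _  = λ ()
    ... | 2F | 1F | _  = λ ()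
mixedTriangle (suc n) {u = inj₁ _} {inj₁ _} {inj₁ _} (old uv) (old vw) (old uw) p q r = mixedTriangle n uv vw uw p q r
mixedTriangle (suc n) {u = inj₂ f} {inj₁ v} {inj₁ w} uv vw uw p q r =
  new-type uv uw (λ eq → TrE⇒≢ vw (cong inj₁ eq)) q r p
mixedTriangle (suc n) {u = inj₁ u} {inj₂ f} {inj₁ w} uv vw uw p q r =
  new-type (E-sym (Tr (suc n)) uv) vw (λ eq → TrE⇒≢ uw (cong inj₁ eq)) p r q
mixedTriangle (suc n) {u = inj₁ u} {inj₁ v} {inj₂ f} uv vw uw p q r =
  new-type (E-sym (Tr (suc n)) uw) (E-sym (Tr (suc n)) vw) (λ eq → TrE⇒≢ uv (cong inj₁ eq)) p q r

spoke-type : ∀ {n b f v} → Mono (byOlder (suc n)) b (inj₂ f) (inj₁ v) → type n v ≡ b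
spoke-type (_ , p) = p

spokes-adjacent : ∀ {n f u v} → TrE (suc n) (inj₂ f) (inj₁ u) → TrE (suc n) (inj₂ f) (inj₁ v) → u ≢ v → TrE n u v
spokes-adjacent {n} (down f i) (down f j) ne = corners-adjacent n f (λ eq → ne (cong (corner n f) eq))

-- A later neighbour in colour `b` already shows the type. With none, the three neighbours are the
-- corners of the face in which the vertex was inserted, all of type `b`, against `mixedTriangle`.
degree≥3⇒type : ∀ n {b v p q r} → p ≢ q → q ≢ r → p ≢ r →
  Mono (byOlder n) b v p → Mono (byOlder n) b v q → Mono (byOlder n) b v r → type n v ≡ b
degree≥3⇒type zero n₁ n₂ n₃ vp vq vr =
  ⊥-elim (noFourInFin3 (TrE⇒≢ (proj₁ vp)) (TrE⇒≢ (proj₁ vq)) (TrE⇒≢ (proj₁ vr)) n₁ n₃ n₂)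
degree≥3⇒type (suc n) {v = inj₁ v} {inj₂ f} n₁ n₂ n₃ vp vq vr = proj₂ vp
degree≥3⇒type (suc n) {v = inj₁ v} {q = inj₂ f} n₁ n₂ n₃ vp vq vr = proj₂ vq
degree≥3⇒type (suc n) {v = inj₁ v} {r = inj₂ f} n₁ n₂ n₃ vp vq vr = proj₂ vr
degree≥3⇒type (suc n) {v = inj₁ v} {inj₁ p} {inj₁ q} {inj₁ r} n₁ n₂ n₃ vp vq vr =
  degree≥3⇒type n (λ eq → n₁ (cong inj₁ eq)) (λ eq → n₂ (cong inj₁ eq)) (λ eq → n₃ (cong inj₁ eq))
    (older-mono vp) (older-mono vq) (older-mono vr)
degree≥3⇒type (suc n) {v = inj₂ f} {inj₁ p} {inj₁ q} {inj₁ r} n₁ n₂ n₃ vp vq vr =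
  ⊥-elim (mixedTriangle n (adj vp vq n₁) (adj vq vr n₂) (adj vp vr n₃) (spoke-type vp) (spoke-type vq) (spoke-type vr))
  where
    adj : ∀ {b u w} → Mono (byOlder (suc n)) b (inj₂ f) (inj₁ u) → Mono (byOlder (suc n)) b (inj₂ f) (inj₁ w) →
      inj₁ u ≢ inj₁ w → TrE n u w
    adj vu vw ne = spokes-adjacent (proj₁ vu) (proj₁ vw) (λ eq → ne (cong inj₁ eq))

-- By induction on the newest vertex. If it is `x` or `y`, both its cycle neighbours have type `b`,
-- so its minority type is not `b`. If it is `z` or `w`, its cycle neighbours are adjacent of type
-- `b` and form a triangle of one type with the remaining vertex.
noTypedCycle : ∀ n {b x y z w} → x ≢ z → y ≢ w → Mono (byOlder n) b x y → Mono (byOlder n) b y z →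
  Mono (byOlder n) b z w → Mono (byOlder n) b w x → type n x ≡ b → type n y ≡ b → ⊥
noTypedCycle zero n₁ n₂ xy yz zw wx tx ty =
  noFourInFin3 (TrE⇒≢ (proj₁ xy)) n₁ (λ eq → TrE⇒≢ (proj₁ wx) (sym eq)) (TrE⇒≢ (proj₁ yz)) n₂ (TrE⇒≢ (proj₁ zw))
noTypedCycle (suc n) {b} {x} {y} {z} {w} n₁ n₂ xy yz zw wx = go x y z w n₁ n₂ xy yz zw wx
  where
    M : Vtx (suc n) → Vtx (suc n) → Set
    M = Mono (byOlder (suc n)) b
    M-sym : ∀ {u v} → M u v → M v u
    M-sym = mono-sym (byOlder (suc n))
    go : ∀ x y z w → x ≢ z → y ≢ w → M x y → M y z → M z w → M w x →
      type (suc n) x ≡ b → type (suc n) y ≡ b → ⊥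
    go (inj₂ f) (inj₁ y) z (inj₁ w) n₁ n₂ xy yz zw wx tx ty =
      new-type (proj₁ xy) (proj₁ (M-sym wx)) (λ eq → n₂ (cong inj₁ eq)) ty (spoke-type (M-sym wx)) tx
    go (inj₁ x) (inj₂ f) (inj₁ z) w n₁ n₂ xy yz zw wx tx ty =
      new-type (proj₁ yz) (proj₁ (M-sym xy)) (λ eq → n₁ (cong inj₁ (sym eq))) (spoke-type yz) tx ty
    go (inj₁ x) (inj₁ y) (inj₁ z) (inj₂ f) n₁ n₂ xy yz zw wx tx ty =
      mixedTriangle n (proj₁ (older-mono xy)) (proj₁ (older-mono yz))
        (spokes-adjacent (proj₁ wx) (proj₁ (M-sym zw)) (λ eq → n₁ (cong inj₁ eq))) tx ty (spoke-type (M-sym zw))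
    go (inj₁ x) (inj₁ y) (inj₂ f) (inj₁ w) n₁ n₂ xy yz zw wx tx ty =
      mixedTriangle n (proj₁ (older-mono xy)) (spokes-adjacent (proj₁ (M-sym yz)) (proj₁ zw) (λ eq → n₂ (cong inj₁ eq)))
        (proj₁ (older-mono (M-sym wx))) tx ty (spoke-type zw)
    go (inj₁ x) (inj₁ y) (inj₁ z) (inj₁ w) n₁ n₂ xy yz zw wx tx ty =
      noTypedCycle n (λ eq → n₁ (cong inj₁ eq)) (λ eq → n₂ (cong inj₁ eq))
        (older-mono xy) (older-mono yz) (older-mono zw) (older-mono wx) tx ty

noTwoPendants : ∀ n {b x y z w p q} → x ≢ z → y ≢ w →
  Mono (byOlder n) b x y → Mono (byOlder n) b y z → Mono (byOlder n) b z w → Mono (byOlder n) b w x →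
  Mono (byOlder n) b x p → p ≢ y → p ≢ w → Mono (byOlder n) b y q → q ≢ x → q ≢ z → ⊥
noTwoPendants n n₁ n₂ xy yz zw wx xp p≢y p≢w yq q≢x q≢z =
  noTypedCycle n n₁ n₂ xy yz zw wx
    (degree≥3⇒type n n₂ (λ eq → p≢w (sym eq)) (λ eq → p≢y (sym eq)) xy (mono-sym (byOlder n) wx) xp)
    (degree≥3⇒type n n₁ (λ eq → q≢z (sym eq)) (λ eq → q≢x (sym eq)) (mono-sym (byOlder n) xy) yz yq)

-- The copies of L in the three colourings give a decidable supergraph of L that avoids all three kinds of patterns.
⟶⇒⊆G : ∀ {m} {L : Graph (Fin m)} → RadiusTwo L → ∃[ n ] (Tr n ⟶ L) →
  ∃[ k ] (1 ≤ k × (L ⊆G Jelly k ⊎ L ⊆G Bistar k))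
⟶⇒⊆G {m} {L} ((o , ecc) , _) (n , arrow) = suc m , s≤s z≤n ,
  Structure.embeds R R? R-sym (λ u → part {n} b₁ (A.emb u)) (λ (r , _) → part-proper {n} b₁ r)
    (λ n₀ n₁ n₂ n₃ xa xb xc ya yb yc → noK₂₃ n (B≢ n₀) (B≢ n₁) (B≢ n₂) (B≢ n₃)
      (inB xa) (inB xb) (inB xc) (inB ya) (inB yb) (inB yc))
    (λ n₁ n₂ xy yz zw wx xp p≢y p≢w yq q≢x q≢z → noTwoPendants n (C≢ n₁) (C≢ n₂)
      (inC xy) (inC yz) (inC zw) (inC wx) (inC xp) (C≢ p≢y) (C≢ p≢w) (inC yq) (C≢ q≢x) (C≢ q≢z))
    o (λ u → near (ecc u)) L⊆R
  where
    b₁ b₂ b₃ : Bool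
    b₁ = proj₁ (arrow (bipartite n))
    b₂ = proj₁ (arrow (alternating n))
    b₃ = proj₁ (arrow (byOlder n))
    module A = MonoCopy (proj₂ (arrow (bipartite n)))
    module B = MonoCopy (proj₂ (arrow (alternating n)))
    module C = MonoCopy (proj₂ (arrow (byOlder n)))
    R : Fin m → Fin m → Set
    R u v = Mono (bipartite n) b₁ (A.emb u) (A.emb v) × Mono (alternating n) b₂ (B.emb u) (B.emb v)
      × Mono (byOlder n) b₃ (C.emb u) (C.emb v)
    mono? : ∀ c b u v → Dec (Mono {n} c b u v)
    mono? c b u v = TrE? n u v ×-dec col c u v ≟ᵇ b
    R? : ∀ u v → Dec (R u v)
    R? u v = mono? (bipartite n) b₁ _ _ ×-dec mono? (alternating n) b₂ _ _ ×-dec mono? (byOlder n) b₃ _ _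
    R-sym : ∀ {u v} → R u v → R v u
    R-sym (a , b , c) = mono-sym (bipartite n) a , mono-sym (alternating n) b , mono-sym (byOlder n) c
    L⊆R : ∀ {u v} → E L u v → R u v
    L⊆R e = (A.emb-E e , A.emb-col e) , (B.emb-E e , B.emb-col e) , (C.emb-E e , C.emb-col e)
    B≢ : ∀ {u v} → u ≢ v → B.emb u ≢ B.emb v
    B≢ ne eq = ne (B.emb-inj eq)
    C≢ : ∀ {u v} → u ≢ v → C.emb u ≢ C.emb v
    C≢ ne eq = ne (C.emb-inj eq)
    inB : ∀ {u v} → R u v → Mono (alternating n) b₂ (B.emb u) (B.emb v)
    inB (_ , r , _) = r
    inC : ∀ {u v} → R u v → Mono (byOlder n) b₃ (C.emb u) (C.emb v)
    inC (_ , _ , r) = r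
    near : ∀ {u} → Within L 2 o u → u ≡ o ⊎ R o u ⊎ ∃[ w ] R o w × R w u
    near Within.here = inj₁ refl
    near (Within.step e Within.here) = inj₂ (inj₁ (L⊆R e))
    near (Within.step e (Within.step e′ Within.here)) = inj₂ (inj₂ (_ , L⊆R e , L⊆R e′))

theorem1p2 : (m : ℕ) (L : Graph (Fin m)) → RadiusTwo L →
    ((∃[ n ] (Tr n ⟶ L)) → ∃[ k ] (1 ≤ k × (L ⊆G Jelly k ⊎ L ⊆G Bistar k)))
    × (∃[ k ] (1 ≤ k × (L ⊆G Jelly k ⊎ L ⊆G Bistar k)) → ∃[ n ] (Tr n ⟶ L))
theorem1p2 m L radius = ⟶⇒⊆G radius , unavoidable
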